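{- For any digraph $G$, \[1+\mathrm{cr}(G)=\mathrm{lifo}_{\mathtt{mi}}(G)=\mathrm{lifo}_{\mathtt{i}}(G)=\mathrm{lifo}_{\mathtt{misc}}(G)=\mathrm{lifo}_{\mathtt{isc}}(G)=\mathrm{lifo}_{\mathtt{mv}}(G)=\mathrm{lifo}_{\mathtt{v}}(G)=\mathrm{lifo}_{\mathtt{mvsc}}(G)=\mathrm{lifo}_{\mathtt{vsc}}(G)=\mathrm{sstat}_{\mathtt{vsc}}(G).\]
   Context: All digraphs are finite, simple, without self-loops and have at least one vertex (induced subgraphs appearing as game data may be empty). For a finite set $V$, $V^*$ is the set of finite words over $V$, $\epsilon$ the empty word; $X \preceq Y$ means $X$ is a prefix of $Y$; for $X=a_1\cdots a_n$, $|X|=n$ and $\mathrm{let}(X)=\{a_1,\dots,a_n\}$. $A\Delta B$ is symmetric difference. For $X\subseteq V(G)$, $G\setminus X$ is the subgraph induced by $V(G)\setminus X$. Induced subgraphs are identified with their vertex sets. An initial component of a digraph $H$ is a strongly connected component $C$ with no edge from $H\setminus C$ into $C$. A subgraph $H\subseteq G$ is successor-closed if there is no edge of $G$ from $H$ to $G\setminus H$. Cycle-rank $\mathrm{cr}(G)$: $0$ if $G$ is acyclic; $1+\min_{v\in V(G)}\mathrm{cr}(G\setminus\{v\})$ if $G$ is strongly connected (and not acyclic); otherwise the maximum of $\mathrm{cr}(H)$ over strongly connected components $H$ of $G$. LIFO-search game. A position is a pair $(X,R)$ with $X\in V(G)^*$ and $R$ a (possibly empty) induced subgraph of $G\setminus\mathrm{let}(X)$.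 It is an $\mathtt{i}$-position if $R$ is successor-closed; an $\mathtt{isc}$-position if $R$ is a union of strongly connected components of $G\setminus\mathrm{let}(X)$; a $\mathtt{v}$-position if $R$ is successor-closed and has a unique initial component; a $\mathtt{vsc}$-position if $R$ is a strongly connected component of $G\setminus\mathrm{let}(X)$. For $\mathbf{gv}\in\{\mathtt{i},\mathtt{isc},\mathtt{v},\mathtt{vsc}\}$, a $\mathbf{gv}$-position $(X',R')$ is a $\mathbf{gv}$-successor of $(X,R)$ if ($X\preceq X'$ or $X'\preceq X$), $|\mathrm{let}(X)\Delta\mathrm{let}(X')|=1$, and: for $\mathbf{gv}\in\{\mathtt{i},\mathtt{v}\}$, every $v'\in R'$ is reachable by a directed path in $G\setminus(\mathrm{let}(X)\cap\mathrm{let}(X'))$ from some $v\in R$; for $\mathbf{gv}\in\{\mathtt{isc},\mathtt{vsc}\}$, every $v'\in R'$ lies in the same strongly connected component of $G\setminus(\mathrm{let}(X)\cap\mathrm{let}(X'))$ as some $v\in R$. For $\mathbf{gv}\in\{\mathtt{v},\mathtt{vsc}\}$, if $(\epsilon,G)$ is not a $\mathbf{gv}$-position it is nevertheless admitted as a special position whose $\mathbf{gv}$-successors are exactly the $\mathbf{gv}$-positions of the form $(\epsilon,R)$. A $\mathbf{gv}$-search from $(X_0,R_0)$ is a finite or infinite sequence of $\mathbf{gv}$-positions $(X_0,R_0),(X_1,R_1),\dots$ with each $(X_{i+1},R_{i+1})$ a $\mathbf{gv}$-successor of $(X_i,R_i)$; it is complete if it is infinite or $R_n=\emptyset$ for some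 $n$, and a complete search is winning for the searchers if $R_n=\emptyset$ for some $n$. A complete search from $(\epsilon,G)$ is monotone if $R_{i+1}\subseteq R_i$ for all $i$; searcher-stationary if $X_i\preceq X_{i+1}$ for all $i$ with $R_i\neq\emptyset$; uses at most $k$ searchers if $|X_i|\le k$ for all $i$. A (searcher) $\mathbf{gv}$-strategy is a function $\sigma$ from $\mathbf{gv}$-positions to $V(G)^*$ such that $\sigma(X,R)$ is the first component of some $\mathbf{gv}$-successor of $(X,R)$; a search is consistent with $\sigma$ if $X_{i+1}=\sigma(X_i,R_i)$ for all $i$. $\sigma$ is winning if every complete consistent search from $(\epsilon,G)$ is winning for the searchers; it is monotone / searcher-stationary / uses at most $k$ searchers if every complete consistent search from $(\epsilon,G)$ has that property. $\mathrm{lifo}_{\mathbf{gv}}(G)$ (resp. $\mathrm{lifo}_{\mathtt{m}\mathbf{gv}}(G)$) is the minimum $k$ such that there is a winning (resp. monotone winning) $\mathbf{gv}$-strategy using at most $k$ searchers; $\mathrm{sstat}_{\mathtt{vsc}}(G)$ is the minimum $k$ such that there is a searcher-stationary winning $\mathtt{vsc}$-strategy using at most $k$ searchers.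
   Formalization: An empty R is admitted as a v- and vsc-position (otherwise no strategy could win), and "successor-closed" for a position (X,R) is taken relative to G∖let(X) rather than G (otherwise one searcher wins on a directed 2-cycle). -}

module Defs where

open import Data.Fin.Base using (Fin; zero; suc; inject₁)
open import Data.Fin.Properties using (any?; all?) renaming (_≟_ to _≟ᶠ_)
open import Data.Fin.Subset
open import Data.Fin.Subset.Induction using (Acc; acc; ⊂-wellFounded; ⊃-wellFounded)
open import Data.Fin.Subset.Properties
open import Data.List.Base using (List; []; _∷_; map; length; allFin; _++_)
open import Data.List.Membership.Propositional using () renaming (_∈_ to _∈ˡ_)
open import Data.List.Membership.Propositional.Properties
  using (∈-allFin; ∈-map⁺; ∈-++⁺ˡ; ∈-++⁺ʳ)
open import Data.List.Relation.Binary.Prefix.Heterogeneous using (Prefix)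
open import Data.List.Relation.Unary.All using (All)
open import Data.List.Relation.Unary.Any using (here; there)
open import Data.Nat.Base using (ℕ; zero; suc; _≤_; _≥_; NonZero)
open import Data.Nat.Properties using (≤-refl; ≤-trans; ≤-total; ≤-antisym)
open import Data.Product using (∃; ∃!; _×_; _,_; proj₁; proj₂)
open import Data.Sum using (_⊎_; inj₁; inj₂; swap)
import Data.Unit.Base as Unit
import Data.Empty as Empty
import Data.Vec.Base as Vec
open import Function.Base using (_∘_; flip)
open import Level using (0ℓ)
open import Relation.Binary.Construct.Closure.ReflexiveTransitive
  using (Star; ε; _◅_; gmap)
open import Relation.Binary.Construct.Closure.Transitive using (TransClosure; [_]; _∷_)
open import Relation.Binary.Core using (Rel)
open import Relation.Binary.Definitions using (Decidable; Irreflexive)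
open import Relation.Binary.PropositionalEquality
  using (_≡_; _≢_; refl; sym; trans; cong; subst)
open import Relation.Nullary
  using (¬_; Dec; yes; no; contradiction; ¬?; _×-dec_; _⊎-dec_; map′)
open import Relation.Nullary.Decidable using (decidable-stable; _→-dec_)

record Digraph : Set₁ where
  field
    order           : ℕ
    .{{nonEmpty}}   : NonZero order
    _⟶_             : Rel (Fin order) 0ℓ
    _⟶?_            : Decidable _⟶_
    irreflexive     : Irreflexive _≡_ _⟶_

IsMinimum : (ℕ → Set) → ℕ → Set
IsMinimum P k = P k × (∀ {j} → P j → k ≤ j)

_△_ : ∀ {n} → Subset n → Subset n → Subset n
p △ q = (p ─ q) ∪ (q ─ p)

x∈p─q⇒x∉q : ∀ {n} {p q : Subset n} {x} → x ∈ p ─ q → x ∉ q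
x∈p─q⇒x∉q {p = _ Vec.∷ _} {outside Vec.∷ _} Vec.here ()
x∈p─q⇒x∉q {p = _ Vec.∷ _} {_ Vec.∷ _} (Vec.there a) (Vec.there b) = x∈p─q⇒x∉q a b

module _ (G : Digraph) where
  open Digraph G

  V : Set
  V = Fin order

  -- Sets of vertices stand for the subgraphs they induce.
  Subgraph : Set
  Subgraph = Subset order

  Edge : Subgraph → Rel V 0ℓ
  Edge H u w = u ∈ H × w ∈ H × u ⟶ w

  Reachable : Subgraph → Rel V 0ℓ
  Reachable H u w = u ∈ H × Star (Edge H) u w

  Acyclic : Subgraph → Set
  Acyclic H = ∀ {v} → ¬ TransClosure (Edge H) v v

  StronglyConnected : Subgraph → Set
  StronglyConnected H = Nonempty H × (∀ {u w} → u ∈ H → w ∈ H → Reachable H u w)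

  IsSCC : Subgraph → Subgraph → Set
  IsSCC H C = C ⊆ H × StronglyConnected C ×
    (∀ {D} → D ⊆ H → StronglyConnected D → C ⊆ D → D ⊆ C)

  SameSCC : Subgraph → Rel V 0ℓ
  SameSCC H u w = ∃ λ C → IsSCC H C × u ∈ C × w ∈ C

  IsInitialComponent : Subgraph → Subgraph → Set
  IsInitialComponent H C =
    IsSCC H C × (∀ {u w} → u ∈ H ─ C → w ∈ C → ¬ u ⟶ w)

  SuccessorClosed : Subgraph → Subgraph → Set
  SuccessorClosed H R = ∀ {u w} → u ∈ R → w ∈ H ─ R → ¬ u ⟶ w

  -- The recursive definition of cycle-rank, as the graph of a function.  The
  -- minimum in `strong` and the maximum in `otherwise` are given by a term
  -- attaining them together with a bound on all terms.
  data CycleRank : Subgraph → ℕ → Set where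
    acyclic   : ∀ {H} → Acyclic H → CycleRank H 0
    strong    : ∀ {H v r} → ¬ Acyclic H → StronglyConnected H →
                v ∈ H → CycleRank (H - v) r →
                (∀ {w} → w ∈ H → ∃ λ s → CycleRank (H - w) s × r ≤ s) →
                CycleRank H (suc r)
    otherwise : ∀ {H C r} → ¬ Acyclic H → ¬ StronglyConnected H →
                IsSCC H C → CycleRank C r →
                (∀ {D} → IsSCC H D → ∃ λ s → CycleRank D s × s ≤ r) →
                CycleRank H r

  cycleRank-unique : ∀ {H r s} → CycleRank H r → CycleRank H s → r ≡ s
  cycleRank-unique (acyclic _) (acyclic _) = refl
  cycleRank-unique (acyclic a) (strong ¬a _ _ _ _) = contradiction (λ {v} → a {v}) ¬a
  cycleRank-unique (acyclic a) (otherwise ¬a _ _ _ _) = contradiction (λ {v} → a {v}) ¬a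
  cycleRank-unique (strong ¬a _ _ _ _) (acyclic a) = contradiction (λ {v} → a {v}) ¬a
  cycleRank-unique (strong _ _ v∈H c f) (strong _ _ w∈H d g)
    with f w∈H | g v∈H
  ... | _ , c′ , r≤ | _ , d′ , s≤ = cong suc (≤-antisym
    (subst (_ ≤_) (cycleRank-unique c′ d) r≤)
    (subst (_ ≤_) (sym (cycleRank-unique c d′)) s≤))
  cycleRank-unique (strong _ sc _ _ _) (otherwise _ ¬sc _ _ _) = contradiction sc ¬sc
  cycleRank-unique (otherwise ¬a _ _ _ _) (acyclic a) = contradiction (λ {v} → a {v}) ¬a
  cycleRank-unique (otherwise _ ¬sc _ _ _) (strong _ sc _ _ _) = contradiction sc ¬sc
  cycleRank-unique (otherwise _ _ C c f) (otherwise _ _ D d g)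
    with f D | g C
  ... | _ , c′ , ≤r | _ , d′ , ≤s = ≤-antisym
    (subst (_≤ _) (sym (cycleRank-unique c d′)) ≤s)
    (subst (_≤ _) (cycleRank-unique c′ d) ≤r)

  ∈-remove : ∀ {H : Subgraph} {u v} → u ∈ H - v → u ∈ H
  ∈-remove {H} {v = v} = p─q⊆p H ⁅ v ⁆

  mono : ∀ {H K u w} → H ⊆ K → Star (Edge H) u w → Star (Edge K) u w
  mono H⊆K = gmap (λ v → v) λ (a , b , e) → H⊆K a , H⊆K b , e

  Avoiding : Subgraph → V → V → V → Set
  Avoiding H u v a = ∃ λ w → Edge H a w × Reachable (H - u) w v

  avoid : ∀ {H} u {a v} → a ∈ H → Star (Edge H) a v →
          u ≡ v ⊎ (Reachable (H - u) a v ⊎ Avoiding H u v u)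
  avoid u {a} a∈H ε with u ≟ᶠ a
  ... | yes u≡a = inj₁ u≡a
  ... | no  u≢a = inj₂ (inj₁ (x∈p∧x≢y⇒x∈p-y a∈H (u≢a ∘ sym) , ε))
  avoid u {a} a∈H (e@(_ , b∈H , a⟶b) ◅ p) with avoid u b∈H p
  ... | inj₁ u≡v = inj₁ u≡v
  ... | inj₂ (inj₂ q) = inj₂ (inj₂ q)
  ... | inj₂ (inj₁ (b∈ , q)) with u ≟ᶠ a
  ... | yes refl = inj₂ (inj₂ (_ , e , b∈ , q))
  ... | no  u≢a  = inj₂ (inj₁ (a∈ , (a∈ , b∈ , a⟶b) ◅ q))
    where a∈ = x∈p∧x≢y⇒x∈p-y a∈H (u≢a ∘ sym)

  edge? : ∀ H u w → Dec (Edge H u w)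
  edge? H u w = u ∈? H ×-dec w ∈? H ×-dec u ⟶? w

  reachable? : ∀ {H} → Acc _⊂_ H → ∀ u v → Dec (Reachable H u v)
  reachable? {H} (acc rec) u v with u ∈? H
  ... | no  u∉H = no (u∉H ∘ proj₁)
  ... | yes u∈H = map′ to from (u ≟ᶠ v ⊎-dec any? λ w →
          edge? H u w ×-dec reachable? (rec (x∈p⇒p-x⊂p u∈H)) w v)
    where
    to : u ≡ v ⊎ Avoiding H u v u → Reachable H u v
    to (inj₁ refl)              = u∈H , ε
    to (inj₂ (_ , e , _ , p))   = u∈H , e ◅ mono ∈-remove p

    from : Reachable H u v → u ≡ v ⊎ Avoiding H u v u
    from (_ , p) with avoid u u∈H p
    ... | inj₁ u≡v = inj₁ u≡v
    ... | inj₂ (inj₂ q) = inj₂ q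
    ... | inj₂ (inj₁ (u∈ , _)) =
      contradiction (x∈⁅x⁆ u) (x∈p─q⇒x∉q u∈)

  cyclic? : ∀ H → Dec (∃ λ v → TransClosure (Edge H) v v)
  cyclic? H = map′ to from (any? λ v → any? λ w →
      edge? H v w ×-dec reachable? (⊂-wellFounded H) w v)
    where
    close : ∀ {a b c} → Edge H a b → Star (Edge H) b c → TransClosure (Edge H) a c
    close e ε       = [ e ]
    close e (f ◅ p) = e ∷ close f p

    open′ : ∀ {a c} → TransClosure (Edge H) a c → Star (Edge H) a c
    open′ [ e ]   = e ◅ ε
    open′ (e ∷ p) = e ◅ open′ p

    to : (∃ λ v → ∃ λ w → Edge H v w × Reachable H w v) → ∃ λ v → TransClosure (Edge H) v v
    to (v , _ , e , _ , p) = v , close e p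

    from : (∃ λ v → TransClosure (Edge H) v v) → ∃ λ v → ∃ λ w → Edge H v w × Reachable H w v
    from (v , [ e ])   = v , v , e , proj₁ e , ε
    from (v , e ∷ p)   = v , _ , e , proj₁ (proj₂ e) , open′ p

  acyclic? : ∀ H → Dec (Acyclic H)
  acyclic? H = map′ (λ ¬c {v} p → ¬c (v , p)) (λ a (_ , p) → a p) (¬? (cyclic? H))

  stronglyConnected? : ∀ H → Dec (StronglyConnected H)
  stronglyConnected? H = nonempty? H ×-dec
    map′ (λ f {u} {w} → f u w) (λ f u w → f) (all? λ u → all? λ w →
      u ∈? H →-dec (w ∈? H →-dec reachable? (⊂-wellFounded H) u w))

  Larger : Subgraph → Subgraph → Subgraph → Set
  Larger H C D = D ⊆ H × StronglyConnected D × C ⊂ D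

  larger? : ∀ H C → Dec (∃ (Larger H C))
  larger? H C = anySubset? λ D → D ⊆? H ×-dec stronglyConnected? D ×-dec C ⊂? D

  ⊆∧⊄⇒⊇ : ∀ {n} {p q : Subset n} → p ⊆ q → ¬ (p ⊂ q) → q ⊆ p
  ⊆∧⊄⇒⊇ {p = p} p⊆q p⊄q {x} x∈q =
    decidable-stable (x ∈? p) λ x∉p → p⊄q (p⊆q , x , x∈q , x∉p)

  maximal : ∀ {H C} → ¬ ∃ (Larger H C) →
            ∀ {D} → D ⊆ H → StronglyConnected D → C ⊆ D → D ⊆ C
  maximal ¬l D⊆H sc C⊆D = ⊆∧⊄⇒⊇ C⊆D λ C⊂D → ¬l (_ , D⊆H , sc , C⊂D)

  isSCC? : ∀ H C → Dec (IsSCC H C)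
  isSCC? H C = C ⊆? H ×-dec stronglyConnected? C ×-dec
    map′ (λ ¬l {D} → maximal ¬l {D})
         (λ m (_ , D⊆H , sc , C⊆D , x , x∈D , x∉C) → x∉C (m D⊆H sc C⊆D x∈D))
         (¬? (larger? H C))

  grow : ∀ {H C} → Acc _⊃_ C → C ⊆ H → StronglyConnected C → ∃ (IsSCC H)
  grow {H} {C} (acc rec) C⊆H sc with larger? H C
  ... | yes (_ , D⊆H , sc′ , C⊂D) = grow (rec C⊂D) D⊆H sc′
  ... | no ¬l = C , C⊆H , sc , λ {D} → maximal ¬l {D}

  someSCC : ∀ {H v} → v ∈ H → ∃ (IsSCC H)
  someSCC {H} {v} v∈H = grow (⊃-wellFounded ⁅ v ⁆)
    (λ x∈ → subst (_∈ H) (sym (x∈⁅y⁆⇒x≡y v x∈)) v∈H)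
    ((v , x∈⁅x⁆ v) , λ {u} u∈ w∈ → u∈ ,
      subst (Star _ u) (trans (x∈⁅y⁆⇒x≡y v u∈) (sym (x∈⁅y⁆⇒x≡y v w∈))) ε)

  subsets : ∀ n → List (Subset n)
  subsets zero    = Vec.[] ∷ []
  subsets (suc n) = map (inside Vec.∷_) (subsets n) ++ map (outside Vec.∷_) (subsets n)

  ∈-subsets : ∀ {n} (p : Subset n) → p ∈ˡ subsets n
  ∈-subsets Vec.[]              = here refl
  ∈-subsets (inside  Vec.∷ p)   = ∈-++⁺ˡ (∈-map⁺ _ (∈-subsets p))
  ∈-subsets (outside Vec.∷ p)   = ∈-++⁺ʳ _ (∈-map⁺ _ (∈-subsets p))

  module _ (_≼_ : Rel ℕ 0ℓ) (≼-refl : ∀ {a} → a ≼ a)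
           (≼-trans : ∀ {a b c} → a ≼ b → b ≼ c → a ≼ c)
           (≼-total : ∀ a b → a ≼ b ⊎ b ≼ a)
           {A : Set} {P : A → Set} (P? : ∀ x → Dec (P x)) {Q : A → ℕ → Set}
           (f : ∀ {x} → P x → ∃ (Q x)) where

    Optimum : List A → Set
    Optimum xs = ∃ λ x → ∃ λ r → P x × Q x r ×
      (∀ {y} → y ∈ˡ xs → P y → ∃ λ s → Q y s × r ≼ s)

    optimum : ∀ xs → (∀ {y} → y ∈ˡ xs → ¬ P y) ⊎ Optimum xs
    optimum [] = inj₁ λ ()
    optimum (x ∷ xs) with P? x | optimum xs
    ... | no ¬p | inj₁ none = inj₁ λ { (here refl) → ¬p ; (there y∈) → none y∈ }
    ... | no ¬p | inj₂ (z , r , pz , qz , best) = inj₂ (z , r , pz , qz ,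
          λ { (here refl) p → contradiction p ¬p ; (there y∈) → best y∈ })
    ... | yes p | inj₁ none = inj₂ (x , _ , p , proj₂ (f p) ,
          λ { (here refl) _ → _ , proj₂ (f p) , ≼-refl
            ; (there y∈) py → contradiction py (none y∈) })
    ... | yes p | inj₂ (z , r , pz , qz , best)
      with f p
    ... | t , q with ≼-total r t
    ... | inj₁ r≼t = inj₂ (z , r , pz , qz ,
          λ { (here refl) _ → t , q , r≼t ; (there y∈) → best y∈ })
    ... | inj₂ t≼r = inj₂ (x , t , p , q ,
          λ { (here refl) _ → t , q , ≼-refl
            ; (there y∈) py → let s , qs , r≼s = best y∈ py in s , qs , ≼-trans t≼r r≼s })

  cycleRank-exists : ∀ {H} → Acc _⊂_ H → ∃ (CycleRank H)
  cycleRank-exists {H} (acc rec) with acyclic? H | stronglyConnected? H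
  ... | yes a | _ = 0 , acyclic (λ {v} → a {v})
  ... | no ¬a | yes sc@((v , v∈H) , _)
    with optimum _≤_ ≤-refl ≤-trans ≤-total (_∈? H) {λ w → CycleRank (H - w)}
           (λ w∈H → cycleRank-exists (rec (x∈p⇒p-x⊂p w∈H))) (allFin order)
  ... | inj₁ none = contradiction v∈H (none (∈-allFin v))
  ... | inj₂ (_ , r , w∈H , c , best) =
    suc r , strong ¬a sc w∈H c λ {w} → best (∈-allFin w)
  cycleRank-exists {H} (acc rec) | no ¬a | no ¬sc
    with optimum _≥_ ≤-refl (flip ≤-trans) (flip ≤-total) (isSCC? H) {CycleRank}
           (λ scc → cycleRank-exists (rec (proper scc))) (subsets order)
    where
    proper : ∀ {C} → IsSCC H C → C ⊂ H
    proper {C} (C⊆H , sc , _) = decidable-stable (C ⊂? H) λ C⊄H →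
      ¬sc (subst StronglyConnected (⊆-antisym C⊆H (⊆∧⊄⇒⊇ C⊆H C⊄H)) sc)
  ... | inj₂ (_ , r , scc , c , best) =
    r , otherwise ¬a ¬sc scc c λ {D} → best (∈-subsets D)
  ... | inj₁ none with cyclic? H
  ... | no acyc = contradiction (λ {v} p → acyc (v , p)) ¬a
  ... | yes (v , p) = contradiction (proj₂ (someSCC (source p))) (none (∈-subsets _))
    where
    source : ∀ {a b} → TransClosure (Edge H) a b → a ∈ H
    source [ a∈H , _ ]     = a∈H
    source ((a∈H , _) ∷ _) = a∈H

  cycleRank : ∃ (CycleRank ⊤)
  cycleRank = cycleRank-exists (⊂-wellFounded ⊤)

  cr : ℕ
  cr = proj₁ cycleRank

  Word : Set
  Word = List V

  letters : Word → Subgraph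
  letters X = ⋃ (map ⁅_⁆ X)

  _≼_ : Rel Word 0ℓ
  _≼_ = Prefix _≡_

  data Variant : Set where
    i isc v vsc : Variant

  Position : Set
  Position = Word × Subgraph

  searchers : Position → Word
  searchers = proj₁

  robber : Position → Subgraph
  robber = proj₂

  -- `Admissible gv H R`: R is a possible robber space when H is the subgraph
  -- left by the searchers.  The empty space is possible in every variant:
  -- with v and vsc it has to be allowed explicitly, as it has no initial
  -- component and is not a strongly connected component.
  Admissible : Variant → Subgraph → Subgraph → Set
  Admissible i   H R = SuccessorClosed H R
  Admissible isc H R = ∃ λ Cs → All (IsSCC H) Cs × R ≡ ⋃ Cs
  Admissible v   H R = R ≡ ⊥ ⊎ (SuccessorClosed H R × ∃! _≡_ (IsInitialComponent R))
  Admissible vsc H R = R ≡ ⊥ ⊎ IsSCC H R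

  IsPosition : Variant → Position → Set
  IsPosition gv (X , R) = R ⊆ ∁ (letters X) × Admissible gv (∁ (letters X)) R

  start : Position
  start = [] , ⊤

  RobberMove : Variant → Subgraph → Rel V 0ℓ
  RobberMove i   = Reachable
  RobberMove isc = SameSCC
  RobberMove v   = Reachable
  RobberMove vsc = SameSCC

  -- `enter` is only ever available with v and vsc, since `start` is always an
  -- i-position and an isc-position.
  data Successor (gv : Variant) : Rel Position 0ℓ where
    move  : ∀ {X R X′ R′} →
            IsPosition gv (X , R) → IsPosition gv (X′ , R′) →
            X ≼ X′ ⊎ X′ ≼ X →
            ∣ letters X △ letters X′ ∣ ≡ 1 →
            (∀ {w} → w ∈ R′ → ∃ λ u → u ∈ R ×
              RobberMove gv (∁ (letters X ∩ letters X′)) u w) →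
            Successor gv (X , R) (X′ , R′)
    enter : ∀ {R} → ¬ IsPosition gv start → IsPosition gv ([] , R) →
            Successor gv start ([] , R)

  IsPosition⁺ : Variant → Position → Set
  IsPosition⁺ gv p = IsPosition gv p ⊎ p ≡ start

  -- `finite m p` is the sequence p 0, …, p m.
  data Sequence : Set where
    finite   : (m : ℕ) → (Fin (suc m) → Position) → Sequence
    infinite : (ℕ → Position) → Sequence

  Index : Sequence → Set
  Index (finite m p) = Fin (suc m)
  Index (infinite p) = ℕ

  at : (s : Sequence) → Index s → Position
  at (finite m p) = p
  at (infinite p) = p

  first : Sequence → Position
  first (finite m p) = p zero
  first (infinite p) = p zero

  -- Step j goes from the j-th position to the next one.
  Step : Sequence → Set
  Step (finite m p) = Fin m
  Step (infinite p) = ℕ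

  before after : (s : Sequence) → Step s → Position
  before (finite m p) j = p (inject₁ j)
  before (infinite p) j = p j
  after  (finite m p) j = p (suc j)
  after  (infinite p) j = p (suc j)

  IsSearchFrom : Variant → Position → Sequence → Set
  IsSearchFrom gv p s =
    first s ≡ p × (∀ n → IsPosition⁺ gv (at s n)) ×
    (∀ j → Successor gv (before s j) (after s j))

  IsInfinite : Sequence → Set
  IsInfinite (finite m p) = Empty.⊥
  IsInfinite (infinite p) = Unit.⊤

  Captures : Sequence → Set
  Captures s = ∃ λ n → robber (at s n) ≡ ⊥

  IsComplete : Sequence → Set
  IsComplete s = IsInfinite s ⊎ Captures s

  IsMonotone : Sequence → Set
  IsMonotone s = ∀ j → robber (after s j) ⊆ robber (before s j)

  IsSearcherStationary : Sequence → Set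
  IsSearcherStationary s = ∀ j → robber (before s j) ≢ ⊥ →
    searchers (before s j) ≼ searchers (after s j)

  UsesAtMost : ℕ → Sequence → Set
  UsesAtMost k s = ∀ n → length (searchers (at s n)) ≤ k

  -- The values of `σ` on pairs that are not gv-positions are irrelevant.
  record Strategy (gv : Variant) : Set where
    field
      σ     : Position → Word
      legal : ∀ {p} → IsPosition⁺ gv p → ∃ λ q → Successor gv p q × searchers q ≡ σ p

  module _ {gv : Variant} (S : Strategy gv) where
    open Strategy S

    IsConsistent : Sequence → Set
    IsConsistent s = ∀ j → searchers (after s j) ≡ σ (before s j)

    -- The plays that quantify the properties of a strategy.
    OnAllPlays : (Sequence → Set) → Set
    OnAllPlays P = ∀ s → IsSearchFrom gv start s → IsComplete s → IsConsistent s → P s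

    Winning Monotone SearcherStationary : Set
    Winning            = OnAllPlays Captures
    Monotone           = OnAllPlays IsMonotone
    SearcherStationary = OnAllPlays IsSearcherStationary

    UsesAtMostSearchers : ℕ → Set
    UsesAtMostSearchers k = OnAllPlays (UsesAtMost k)

  IsLifo : Variant → ℕ → Set
  IsLifo gv = IsMinimum λ k → ∃ λ (S : Strategy gv) →
    Winning S × UsesAtMostSearchers S k

  IsLifoᵐ : Variant → ℕ → Set
  IsLifoᵐ gv = IsMinimum λ k → ∃ λ (S : Strategy gv) →
    Monotone S × Winning S × UsesAtMostSearchers S k

  IsSstatVsc : ℕ → Set
  IsSstatVsc = IsMinimum λ k → ∃ λ (S : Strategy vsc) →
    SearcherStationary S × Winning S × UsesAtMostSearchers S k

{-# OPTIONS --safe #-}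
-- Upper bounds.  Call the zone of a searcher the strongly connected component it was placed
-- in, minus its vertex.  The same strategy works in all four games: while the robber space
-- meets the zone of the last searcher, place the next one on a vertex of minimal remaining
-- cycle-rank in a component of that intersection which the rest of the robber space cannot reach;
-- otherwise lift the last searcher.  Unreachability makes lifting monotone, the ranks of the
-- nested components bound the number of searchers, and 2|R| + |X| decreases in every round.
--
-- Lower bounds.  Starting from a component of maximal rank, pass at every letter of the
-- searchers' word to a component of maximal rank of what is left.  This loses at most one
-- unit of rank per letter, so it never fails while |X| ≤ cr G, and words that are prefixes of
-- each other give nested components, between which the robber can move.
module Submission where

open import Defs
open import Data.Bool.Properties using () renaming (_≟_ to _≟ᵇ_)
open import Data.Fin.Base using (Fin; zero; suc; inject₁)
open import Data.Fin.Induction using (<-weakInduction)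
open import Data.Fin.Properties using (any?; all?) renaming (_≟_ to _≟ᶠ_)
open import Data.Fin.Subset
open import Data.Fin.Subset.Induction using (Acc; acc; ⊂-wellFounded)
open import Data.Fin.Subset.Properties
open import Data.List.Base using (List; []; _∷_; _∷ʳ_; _++_; foldl; length; map; allFin)
open import Data.List.Membership.Propositional using () renaming (_∈_ to _∈ˡ_)
open import Data.List.Membership.Propositional.Properties using (∈-allFin; ∈-map⁺)
open import Data.List.Properties using (length-++; ∷ʳ-injective)
open import Data.List.Relation.Binary.Prefix.Heterogeneous using ([]; _∷_; _++ᵖ_)
open import Data.List.Relation.Unary.All using (All; []; _∷_; universal)
open import Data.List.Relation.Unary.All.Properties using (map⁺)
open import Data.List.Relation.Unary.Any using (here; there)
open import Data.List.Reverse using (Reverse; []; _∶_∶ʳ_; reverseView)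
open import Data.Nat using (ℕ; zero; suc; _+_; _≤_; _<_; z≤n; s≤s; NonZero)
import Data.Nat.Properties as ℕ
open import Data.Product using (∃; ∃!; _×_; _,_; proj₁; proj₂)
open import Data.Sum using (_⊎_; inj₁; inj₂; [_,_]′)
open import Data.Unit.Base using (tt)
open import Data.Vec.Base using (tabulate)
open import Data.Vec.Properties using (lookup⇒[]=; []=⇒lookup; lookup∘tabulate; ≡-dec)
open import Function.Base using (_∘_; id)
open import Relation.Binary.Construct.Closure.ReflexiveTransitive using (Star; ε; _◅_; _◅◅_)
open import Relation.Binary.Construct.Closure.Transitive using (TransClosure; [_]; _∷_)
open import Relation.Binary.PropositionalEquality
  using (_≡_; _≢_; refl; sym; trans; cong; subst)
open import Relation.Nullary using (¬_; Dec; yes; no; contradiction; ¬?; _×-dec_; does; map′)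
open import Relation.Nullary.Decidable using (dec-true; decidable-stable; _→-dec_)

-- Finite subsets, and lists read from the last letter.

module _ {n} {P : Fin n → Set} (P? : ∀ x → Dec (P x)) where

  comprehension : Subset n
  comprehension = tabulate (does ∘ P?)

  ∈-comprehension⁺ : ∀ {x} → P x → x ∈ comprehension
  ∈-comprehension⁺ {x} px = lookup⇒[]= x comprehension
    (trans (lookup∘tabulate (does ∘ P?) x) (dec-true (P? x) px))

  ∈-comprehension⁻ : ∀ {x} → x ∈ comprehension → P x
  ∈-comprehension⁻ {x} x∈ with P? x | trans (sym (lookup∘tabulate (does ∘ P?) x)) ([]=⇒lookup x∈)
  ... | yes px | _ = px
  ... | no  _  | ()

∉-remove : ∀ {n} {p : Subset n} {x} → x ∉ p - x
∉-remove x∈ = x∈p─q⇒x∉q x∈ (x∈⁅x⁆ _)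

remove-∉ : ∀ {n} {p : Subset n} {x} → x ∉ p → p - x ≡ p
remove-∉ {p = p} {x} x∉p = ⊆-antisym (p─q⊆p p ⁅ x ⁆)
  λ y∈p → x∈p∧x≢y⇒x∈p-y y∈p λ { refl → x∉p y∈p }

remove-mono : ∀ {n} {p q : Subset n} x → p ⊆ q → p - x ⊆ q - x
remove-mono {p = p} x p⊆q y∈ = x∈p∧x∉q⇒x∈p─q (p⊆q (p─q⊆p p ⁅ x ⁆ y∈)) (x∈p─q⇒x∉q y∈)

⊤─≡∁ : ∀ {n} (p : Subset n) → ⊤ ─ p ≡ ∁ p
⊤─≡∁ p = ⊆-antisym (λ x∈ → x∉p⇒x∈∁p (x∈p─q⇒x∉q x∈))
  (λ x∈ → x∈p∧x∉q⇒x∈p─q ∈⊤ (x∈∁p⇒x∉p x∈))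

nonempty≢⊥ : ∀ {n} {p : Subset n} → Nonempty p → p ≢ ⊥
nonempty≢⊥ (_ , x∈) refl = ∉⊥ x∈

∄⇒≡⊥ : ∀ {n} {p : Subset n} → (∀ {x} → x ∉ p) → p ≡ ⊥
∄⇒≡⊥ none = Empty-unique λ (_ , x∈) → none x∈

-- `reverseView` does not reduce on `X ∷ʳ a`. Uniqueness of the view evaluates there the functions
-- on words that recurse from the last letter.
reverse-unique : ∀ {A : Set} {xs ys : List A} (rs : Reverse xs) (ss : Reverse ys) (eq : xs ≡ ys) →
                 subst Reverse eq rs ≡ ss
reverse-unique [] [] refl = refl
reverse-unique [] ([] ∶ _ ∶ʳ _) ()
reverse-unique [] ((_ ∷ _) ∶ _ ∶ʳ _) ()
reverse-unique ([] ∶ _ ∶ʳ _) [] ()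
reverse-unique ((_ ∷ _) ∶ _ ∶ʳ _) [] ()
reverse-unique (xs ∶ rs ∶ʳ x) (ys ∶ ss ∶ʳ y) eq with ∷ʳ-injective xs ys eq
reverse-unique (xs ∶ rs ∶ʳ x) (.xs ∶ ss ∶ʳ .x) refl | refl , refl =
  cong (λ rs → xs ∶ rs ∶ʳ x) (reverse-unique rs ss refl)

△-comm : ∀ {n} (p q : Subset n) → p △ q ≡ q △ p
△-comm p q = ∪-comm (p ─ q) (q ─ p)

△-insert : ∀ {n} {p : Subset n} {x} → x ∉ p → p △ (p ∪ ⁅ x ⁆) ≡ ⁅ x ⁆
△-insert {p = p} {x} x∉p = ⊆-antisym to from
  where
  to : p △ (p ∪ ⁅ x ⁆) ⊆ ⁅ x ⁆
  to y∈ with x∈p∪q⁻ (p ─ (p ∪ ⁅ x ⁆)) ((p ∪ ⁅ x ⁆) ─ p) y∈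
  ... | inj₁ y∈′ = contradiction (p⊆p∪q ⁅ x ⁆ (p─q⊆p p (p ∪ ⁅ x ⁆) y∈′)) (x∈p─q⇒x∉q y∈′)
  ... | inj₂ y∈′ with x∈p∪q⁻ p ⁅ x ⁆ (p─q⊆p (p ∪ ⁅ x ⁆) p y∈′)
  ... | inj₁ y∈p = contradiction y∈p (x∈p─q⇒x∉q y∈′)
  ... | inj₂ y∈x = y∈x

  from : ⁅ x ⁆ ⊆ p △ (p ∪ ⁅ x ⁆)
  from y∈ with x∈⁅y⁆⇒x≡y x y∈
  ... | refl = q⊆p∪q (p ─ (p ∪ ⁅ x ⁆)) ((p ∪ ⁅ x ⁆) ─ p)
    (x∈p∧x∉q⇒x∈p─q (q⊆p∪q p ⁅ x ⁆ y∈) x∉p)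

∈-⋃⁺ : ∀ {n} {p : Subset n} {ps x} → x ∈ p → p ∈ˡ ps → x ∈ ⋃ ps
∈-⋃⁺ {ps = _ ∷ ps} x∈ (here refl) = p⊆p∪q (⋃ ps) x∈
∈-⋃⁺ {ps = q ∷ ps} x∈ (there p∈)  = q⊆p∪q q (⋃ ps) (∈-⋃⁺ x∈ p∈)

⋃-closed : ∀ {n} {P : Subset n → Set} {ps : List (Subset n)} {x y} → All P ps →
           (∀ {p} → P p → x ∈ p → y ∈ p) → x ∈ ⋃ ps → y ∈ ⋃ ps
⋃-closed [] _ x∈ = contradiction x∈ ∉⊥
⋃-closed {ps = p ∷ ps} (px ∷ pxs) f x∈ with x∈p∪q⁻ p (⋃ ps) x∈
... | inj₁ x∈p = p⊆p∪q (⋃ ps) (f px x∈p)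
... | inj₂ x∈ps = q⊆p∪q p (⋃ ps) (⋃-closed pxs f x∈ps)

-- Strongly connected components and cycle-rank.

module Components (G : Digraph) where
  open Digraph G using (order; _⟶_; irreflexive)

  someVertex : Fin order
  someVertex = go order
    where
    go : ∀ n → .{{NonZero n}} → Fin n
    go (suc n) = zero

  reachable-trans : ∀ {H a b c} → Reachable G H a b → Reachable G H b c → Reachable G H a c
  reachable-trans (a∈ , p) (_ , q) = a∈ , p ◅◅ q

  reachable-mono : ∀ {H K a b} → H ⊆ K → Reachable G H a b → Reachable G K a b
  reachable-mono H⊆K (a∈ , p) = H⊆K a∈ , mono G H⊆K p

  walk-target : ∀ {H a b} → a ∈ H → Star (Edge G H) a b → b ∈ H
  walk-target a∈ ε                     = a∈
  walk-target _  ((_ , b∈ , _) ◅ p)    = walk-target b∈ p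

  reachable-target : ∀ {H a b} → Reachable G H a b → b ∈ H
  reachable-target (a∈ , p) = walk-target a∈ p

  Reachable? : ∀ H a b → Dec (Reachable G H a b)
  Reachable? H = reachable? G (⊂-wellFounded H)

  Mutual : Subgraph G → Fin order → Fin order → Set
  Mutual H a b = Reachable G H a b × Reachable G H b a

  comp : Subgraph G → Fin order → Subgraph G
  comp H a = comprehension λ b → Reachable? H a b ×-dec Reachable? H b a

  ∈-comp⁺ : ∀ {H a b} → Mutual H a b → b ∈ comp H a
  ∈-comp⁺ {H} {a} = ∈-comprehension⁺ λ b → Reachable? H a b ×-dec Reachable? H b a

  ∈-comp⁻ : ∀ {H a b} → b ∈ comp H a → Mutual H a b
  ∈-comp⁻ {H} {a} = ∈-comprehension⁻ λ b → Reachable? H a b ×-dec Reachable? H b a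

  comp⊆ : ∀ {H a} → comp H a ⊆ H
  comp⊆ b∈ = proj₁ (proj₂ (∈-comp⁻ b∈))

  self∈comp : ∀ {H a} → a ∈ H → a ∈ comp H a
  self∈comp a∈ = ∈-comp⁺ ((a∈ , ε) , (a∈ , ε))

  walk-in-comp : ∀ {H a b c} → Reachable G H a b → Star (Edge G H) b c → Reachable G H c a →
                 Star (Edge G (comp H a)) b c
  walk-in-comp r ε s = ε
  walk-in-comp r@(a∈ , p) (e@(b∈ , d∈ , b⟶d) ◅ q) s =
    (∈-comp⁺ (r , (b∈ , e ◅ q ◅◅ proj₂ s)) , ∈-comp⁺ (r′ , (d∈ , q ◅◅ proj₂ s)) , b⟶d)
      ◅ walk-in-comp r′ q s
    where r′ = a∈ , p ◅◅ e ◅ ε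

  comp-isSCC : ∀ {H a} → a ∈ H → IsSCC G H (comp H a)
  comp-isSCC {H} {a} a∈H = comp⊆ , ((a , self∈comp a∈H) , connected) , maximal′
    where
    connected : ∀ {b c} → b ∈ comp H a → c ∈ comp H a → Reachable G (comp H a) b c
    connected b∈ c∈ with ∈-comp⁻ b∈ | ∈-comp⁻ c∈
    ... | r , (_ , p) | (_ , q) , s = b∈ , walk-in-comp r (p ◅◅ q) s

    maximal′ : ∀ {D} → D ⊆ H → StronglyConnected G D → comp H a ⊆ D → D ⊆ comp H a
    maximal′ D⊆H (_ , sc) C⊆D b∈D =
      ∈-comp⁺ (reachable-mono D⊆H (sc a∈D b∈D) , reachable-mono D⊆H (sc b∈D a∈D))
      where a∈D = C⊆D (self∈comp a∈H)

  sc⇒⊆comp : ∀ {H D a} → StronglyConnected G D → D ⊆ H → a ∈ D → D ⊆ comp H a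
  sc⇒⊆comp (_ , sc) D⊆H a∈D b∈D =
    ∈-comp⁺ (reachable-mono D⊆H (sc a∈D b∈D) , reachable-mono D⊆H (sc b∈D a∈D))

  isSCC⇒≡comp : ∀ {H C a} → IsSCC G H C → a ∈ C → C ≡ comp H a
  isSCC⇒≡comp (C⊆H , sc , max) a∈C with comp-isSCC (C⊆H a∈C)
  ... | K⊆H , sc′ , _ = ⊆-antisym C⊆K (max K⊆H sc′ C⊆K)
    where C⊆K = sc⇒⊆comp sc C⊆H a∈C

  isSCC-unique : ∀ {H C D a} → IsSCC G H C → IsSCC G H D → a ∈ C → a ∈ D → C ≡ D
  isSCC-unique C D a∈C a∈D = trans (isSCC⇒≡comp C a∈C) (sym (isSCC⇒≡comp D a∈D))

  sc-absorbed : ∀ {H C D a} → IsSCC G H C → StronglyConnected G D → D ⊆ H →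
                a ∈ C → a ∈ D → D ⊆ C
  sc-absorbed C sc D⊆H a∈C a∈D b∈D =
    subst (_ ∈_) (sym (isSCC⇒≡comp C a∈C)) (sc⇒⊆comp sc D⊆H a∈D b∈D)

  mutual-absorbed : ∀ {H C a b} → IsSCC G H C → a ∈ C → Mutual H a b → b ∈ C
  mutual-absorbed C a∈C m = subst (_ ∈_) (sym (isSCC⇒≡comp C a∈C)) (∈-comp⁺ m)

  isSCC-restrict : ∀ {H K C} → IsSCC G H C → K ⊆ H → C ⊆ K → IsSCC G K C
  isSCC-restrict (_ , sc , max) K⊆H C⊆K = C⊆K , sc ,
    λ D⊆K → max (K⊆H ∘ D⊆K)

  -- `C` absorbs every strongly connected subset of `H` that meets it. A strongly connected superset
  -- of `D` avoiding `a` therefore stays inside `C - a`, where `D` is maximal.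
  isSCC-nested : ∀ {H C D} a → IsSCC G H C → IsSCC G (C - a) D → IsSCC G (H - a) D
  isSCC-nested {H} {C} {D} a C-scc@(C⊆H , _) (D⊆ , sc@((b , b∈D) , _) , max) =
    remove-mono a C⊆H ∘ D⊆ , sc , λ E⊆ sc′ D⊆E → max
      (λ e∈E → x∈p∧x∉q⇒x∈p─q
        (sc-absorbed C-scc sc′ (∈-remove G ∘ E⊆) (∈-remove G (D⊆ b∈D)) (D⊆E b∈D) e∈E)
        (x∈p─q⇒x∉q (E⊆ e∈E))) sc′ D⊆E

  sameSCC⇒mutual : ∀ {H a b} → SameSCC G H a b → Mutual H a b
  sameSCC⇒mutual (C , (C⊆H , (_ , sc) , _) , a∈ , b∈) =
    reachable-mono C⊆H (sc a∈ b∈) , reachable-mono C⊆H (sc b∈ a∈)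

  mutual⇒sameSCC : ∀ {H a b} → Mutual H a b → SameSCC G H a b
  mutual⇒sameSCC m@((a∈H , _) , _) = _ , comp-isSCC a∈H , self∈comp a∈H , ∈-comp⁺ m

  -- Abstract, since `with` would otherwise normalise the decision procedure of Defs.
  abstract
    rank : Subgraph G → ℕ
    rank H = proj₁ (cycleRank-exists G (⊂-wellFounded H))

    rank-correct : ∀ H → CycleRank G H (rank H)
    rank-correct H = proj₂ (cycleRank-exists G (⊂-wellFounded H))

    rank-⊤ : rank ⊤ ≡ cr G
    rank-⊤ = refl

  rank≡ : ∀ {H r} → CycleRank G H r → rank H ≡ r
  rank≡ {H} = cycleRank-unique G (rank-correct H)

  acyclic-⊆ : ∀ {H K} → K ⊆ H → Acyclic G H → Acyclic G K
  acyclic-⊆ {H} {K} K⊆H a p = a (lift p)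
    where
    lift : ∀ {b c} → TransClosure (Edge G K) b c → TransClosure (Edge G H) b c
    lift [ b∈ , c∈ , e ]     = [ K⊆H b∈ , K⊆H c∈ , e ]
    lift ((b∈ , c∈ , e) ∷ p) = (K⊆H b∈ , K⊆H c∈ , e) ∷ lift p

  rank-scc-≤ : ∀ {H C} → IsSCC G H C → rank C ≤ rank H
  rank-scc-≤ {H} {C} C-scc@(C⊆H , sc@((a , a∈C) , _) , max) with rank H | rank-correct H
  ... | _ | acyclic ac =
    ℕ.≤-reflexive (rank≡ (acyclic (acyclic-⊆ C⊆H (λ {x} → ac {x}))))
  ... | _ | c@(strong _ sc′ _ _ _) =
    ℕ.≤-reflexive (rank≡ (subst (λ K → CycleRank G K _) (⊆-antisym (max id sc′ C⊆H) C⊆H) c))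
  ... | r | otherwise _ _ _ _ best with best C-scc
  ... | s , c , s≤r = subst (_≤ r) (sym (rank≡ c)) s≤r

  rank-attained : ∀ {H} → Nonempty H → ∃ λ C → IsSCC G H C × rank C ≡ rank H
  rank-attained {H} (a , a∈H) with rank H | rank-correct H
  ... | _ | acyclic ac = comp H a , comp-isSCC a∈H ,
    rank≡ (acyclic (acyclic-⊆ comp⊆ (λ {x} → ac {x})))
  ... | _ | c@(strong _ sc _ _ _) = H , (id , sc , λ D⊆H _ _ → D⊆H) , rank≡ c
  ... | _ | otherwise _ _ C c _ = _ , C , rank≡ c

  sole-vertex-acyclic : ∀ {H a} → Empty (H - a) → Acyclic G H
  sole-vertex-acyclic {H} {a} empty = noCycle
    where
    only : ∀ {b} → b ∈ H → b ≡ a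
    only {b} b∈H = decidable-stable (b ≟ᶠ a) λ b≢a → empty (b , x∈p∧x≢y⇒x∈p-y b∈H b≢a)

    noEdge : ∀ {b c} → ¬ Edge G H b c
    noEdge (b∈ , c∈ , b⟶c) = irreflexive (trans (only b∈) (sym (only c∈))) b⟶c

    noCycle : Acyclic G H
    noCycle [ e ]   = noEdge e
    noCycle (e ∷ _) = noEdge e

  -- By the minimum in `strong`, deleting any vertex costs at most one unit of rank. Positive rank
  -- excludes a single vertex, which is acyclic because there are no loops.
  rank-remove : ∀ {C r} a → StronglyConnected G C → suc r ≤ rank C →
                Nonempty (C - a) × r ≤ rank (C - a)
  rank-remove {C} {r} a sc r<rank = nonempty , bound r<rank
    where
    nonempty : Nonempty (C - a)
    nonempty = decidable-stable (nonempty? (C - a)) λ empty → ℕ.n≮0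
      (subst (suc r ≤_) (rank≡ (acyclic (λ {x} → sole-vertex-acyclic empty {x}))) r<rank)

    bound : suc r ≤ rank C → r ≤ rank (C - a)
    bound r< with a ∈? C
    ... | no a∉C rewrite remove-∉ a∉C = ℕ.<⇒≤ r<
    ... | yes a∈C with rank C | rank-correct C | r<
    ... | _ | strong _ _ _ _ best | s≤s r≤t with best a∈C
    ... | s , c , t≤s = ℕ.≤-trans r≤t (subst (_ ≤_) (sym (rank≡ c)) t≤s)
    bound _ | yes _ | _ | otherwise _ ¬sc _ _ _ | _ = contradiction sc ¬sc

  hub-exists : ∀ {C} → StronglyConnected G C →
               ∃ λ a → a ∈ C × (∀ {E} → IsSCC G (C - a) E → rank E < rank C)
  hub-exists {C} sc@((a , a∈C) , _) with rank C | rank-correct C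
  ... | _ | strong {v = b} _ _ b∈C c _ = b , b∈C , λ E → s≤s
    (subst (_ ≤_) (rank≡ c) (rank-scc-≤ E))
  ... | _ | otherwise _ ¬sc _ _ _ = contradiction sc ¬sc
  -- No rank is below 0, so `C - a` must have no component at all: a second vertex would lie on a
  -- closed walk with `a`.
  ... | _ | acyclic ac = a , a∈C , λ (E⊆ , ((b , b∈E) , _) , _) →
    contradiction (cycle (∈-remove G (E⊆ b∈E)) (λ { refl → ∉-remove (E⊆ b∈E) })) ac′
    where
    ac′ : ¬ ∃ λ b → TransClosure (Edge G C) b b
    ac′ (_ , p) = ac p

    close : ∀ {b c d} → Edge G C b c → Star (Edge G C) c d → TransClosure (Edge G C) b d
    close e ε       = [ e ]
    close e (f ◅ p) = e ∷ close f p

    cycle : ∀ {b} → b ∈ C → b ≢ a → ∃ λ b → TransClosure (Edge G C) b b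
    cycle b∈C b≢a with proj₂ sc b∈C a∈C
    ... | _ , ε     = contradiction refl b≢a
    ... | _ , e ◅ p = _ , close e (p ◅◅ proj₂ (proj₂ sc a∈C b∈C))

  closed-reachable : ∀ {H R u w} → SuccessorClosed G H R → u ∈ R → Star (Edge G H) u w →
                     Star (Edge G R) u w
  closed-reachable closed u∈ ε = ε
  closed-reachable {H} {R} closed u∈ ((_ , b∈H , u⟶b) ◅ p) =
    (u∈ , b∈ , u⟶b) ◅ closed-reachable closed b∈ p
    where
    b∈ = decidable-stable (_ ∈? R) λ b∉ → closed u∈ (x∈p∧x∉q⇒x∈p─q b∈H b∉) u⟶b

  mutual⇒move : ∀ gv {K u w} → Mutual K u w → RobberMove G gv K u w
  mutual⇒move i   = proj₁
  mutual⇒move isc = mutual⇒sameSCC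
  mutual⇒move v   = proj₁
  mutual⇒move vsc = mutual⇒sameSCC

  ⊥-isPosition : ∀ gv {X} → IsPosition G gv (X , ⊥)
  ⊥-isPosition gv = ⊆-min _ , admissible gv
    where
    admissible : ∀ gv {H} → Admissible G gv H ⊥
    admissible i   u∈ = contradiction u∈ ∉⊥
    admissible isc    = [] , [] , refl
    admissible v      = inj₁ refl
    admissible vsc    = inj₁ refl

-- Lower bounds: a robber evading `cr G` searchers.

module Evasion (G : Digraph) where
  open Digraph G using (order; _⟶_)
  open Components G

  abstract
    core : Subgraph G → Subgraph G
    core H with nonempty? H
    ... | yes ne = proj₁ (rank-attained ne)
    ... | no  _  = ⊥

    core-correct : ∀ {H} → Nonempty H → IsSCC G H (core H) × rank (core H) ≡ rank H
    core-correct {H} ne with nonempty? H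
    ... | yes ne′ = proj₂ (rank-attained ne′)
    ... | no  ¬ne = contradiction ne ¬ne

    core⊆ : ∀ {H} → core H ⊆ H
    core⊆ {H} with nonempty? H
    ... | yes ne = proj₁ (proj₁ (proj₂ (rank-attained ne)))
    ... | no  _  = λ x∈ → contradiction x∈ ∉⊥

  retire : Subgraph G → Fin order → Subgraph G
  retire C a = core (C - a)

  retires-⊆ : ∀ {C} X → foldl retire C X ⊆ C
  retires-⊆ []      = id
  retires-⊆ (a ∷ X) = ∈-remove G ∘ core⊆ ∘ retires-⊆ X

  -- The length hypothesis is a rank budget: each letter uses one unit of it and, by `rank-remove`,
  -- costs at most one unit of rank. So no removal empties the set, and `isSCC-nested` carries the
  -- new core up to the surrounding graph.
  retires-isSCC : ∀ {H C} X → IsSCC G H C → length X ≤ rank C →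
                  IsSCC G (H ─ letters G X) (foldl retire C X)
  retires-isSCC {H} [] C-scc _ = subst (λ K → IsSCC G K _) (sym (p─⊥≡p H)) C-scc
  retires-isSCC {H} {C} (a ∷ X) C-scc@(_ , sc , _) len with rank-remove a sc len
  ... | ne , len′ with core-correct ne
  ... | D-scc , same = subst (λ K → IsSCC G K _) (p─q─r≡p─q∪r H ⁅ a ⁆ (letters G X))
    (retires-isSCC X (isSCC-nested a C-scc D-scc) (ℕ.≤-trans len′ (ℕ.≤-reflexive (sym same))))

  shelter : Word G → Subgraph G
  shelter = foldl retire (core ⊤)

  shelter-isSCC : ∀ X → length X ≤ cr G → IsSCC G (∁ (letters G X)) (shelter X)
  shelter-isSCC X len with core-correct {⊤} (someVertex , ∈⊤)
  ... | C-scc , same = subst (λ K → IsSCC G K (shelter X)) (⊤─≡∁ (letters G X))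
    (retires-isSCC X C-scc (ℕ.≤-trans len (ℕ.≤-reflexive (sym (trans same rank-⊤)))))

  -- The fold reads a word from its first letter, so a longer word continues the descent of its
  -- prefix.
  shelter-anti : ∀ {X Y} → _≼_ G X Y → shelter Y ⊆ shelter X
  shelter-anti {X} {Y} = go {core ⊤}
    where
    go : ∀ {C X Y} → _≼_ G X Y → foldl retire C Y ⊆ foldl retire C X
    go {Y = Y} []   = retires-⊆ Y
    go (refl ∷ pre) = go pre

  Out : Subgraph G → Subgraph G → Fin order → Set
  Out H C b = ∃ λ a → a ∈ C × Reachable G H a b

  out? : ∀ H C b → Dec (Out H C b)
  out? H C b = any? λ a → a ∈? C ×-dec Reachable? H a b

  outset : Subgraph G → Subgraph G → Subgraph G
  outset H C = comprehension (out? H C)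

  -- The robber's home is a component in every game; where spaces are successor-closed it is
  -- enlarged to its forward closure.
  place : Variant G → Subgraph G → Subgraph G → Subgraph G
  place i   = outset
  place isc = λ _ C → C
  place v   = outset
  place vsc = λ _ C → C

  C⊆out : ∀ {H C} → C ⊆ H → C ⊆ outset H C
  C⊆out {H} {C} C⊆H a∈ = ∈-comprehension⁺ (out? H C) (_ , a∈ , C⊆H a∈ , ε)

  outset-⊆ : ∀ {H C} → outset H C ⊆ H
  outset-⊆ {H} {C} b∈ = reachable-target (proj₂ (proj₂ (∈-comprehension⁻ (out? H C) b∈)))

  out-closed : ∀ {H C} → SuccessorClosed G H (outset H C)
  out-closed {H} {C} u∈ w∈ u⟶w with ∈-comprehension⁻ (out? H C) u∈
  ... | a , a∈C , (a∈H , p) = x∈p─q⇒x∉q w∈ (∈-comprehension⁺ (out? H C)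
    (a , a∈C , a∈H , p ◅◅ (outset-⊆ u∈ , p─q⊆p H (outset H C) w∈ , u⟶w) ◅ ε))

  initial-pulls-back : ∀ {R D a b} → IsInitialComponent G R D → Star (Edge G R) a b → b ∈ D → a ∈ D
  initial-pulls-back I ε b∈ = b∈
  initial-pulls-back {D = D} I@(_ , noEntry) ((a∈R , _ , a⟶c) ◅ p) b∈ =
    decidable-stable (_ ∈? D) λ a∉ →
      noEntry (x∈p∧x∉q⇒x∈p─q a∈R a∉) (initial-pulls-back I p b∈) a⟶c

  -- A vertex with an edge into `C` that is also reachable from `C` lies on a closed walk through
  -- `C`, hence in `C`.
  out-initial : ∀ {H C} → IsSCC G H C → IsInitialComponent G (outset H C) C
  out-initial {H} {C} C-scc@(C⊆H , (_ , sc) , _) = isSCC-restrict C-scc outset-⊆ (C⊆out C⊆H) , noEntry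
    where
    noEntry : ∀ {u w} → u ∈ outset H C ─ C → w ∈ C → ¬ u ⟶ w
    noEntry u∈ w∈C u⟶w with ∈-comprehension⁻ (out? H C) (p─q⊆p (outset H C) C u∈)
    ... | a , a∈C , r = x∈p─q⇒x∉q u∈ (mutual-absorbed C-scc a∈C
      (r , reachable-target r , (reachable-target r , C⊆H w∈C , u⟶w) ◅ proj₂ (reachable-mono C⊆H (sc w∈C a∈C))))

  place-admissible : ∀ gv {H C} → IsSCC G H C → Admissible G gv H (place gv H C)
  place-admissible i   C-scc = out-closed
  place-admissible isc C-scc = _ ∷ [] , C-scc ∷ [] , sym (∪-identityʳ _)
  place-admissible v   C-scc@(C⊆H , _) = inj₂ (out-closed , _ , out-initial C-scc , unique)
    where
    -- A vertex of another initial component `D` is reached from some `a` in `C`. No edge enters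
    -- `D`, so the walk can be followed backwards and `a` lies in `D` too.
    unique : ∀ {D} → IsInitialComponent G (outset _ _) D → _ ≡ D
    unique I@(D-scc@(D⊆ , ((d , d∈D) , _) , _) , _) with ∈-comprehension⁻ (out? _ _) (D⊆ d∈D)
    ... | a , a∈C , (_ , p) = isSCC-unique (proj₁ (out-initial C-scc)) D-scc a∈C
      (initial-pulls-back I (closed-reachable out-closed (C⊆out C⊆H a∈C) p) d∈D)
  place-admissible vsc C-scc = inj₂ C-scc

  place⊆ : ∀ gv {H C} → C ⊆ H → place gv H C ⊆ H
  place⊆ i   C⊆H = outset-⊆
  place⊆ isc C⊆H = C⊆H
  place⊆ v   C⊆H = outset-⊆
  place⊆ vsc C⊆H = C⊆H

  ⊆place : ∀ gv {H C} → C ⊆ H → C ⊆ place gv H C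
  ⊆place i   C⊆H = C⊆out C⊆H
  ⊆place isc C⊆H = id
  ⊆place v   C⊆H = C⊆out C⊆H
  ⊆place vsc C⊆H = id

  -- In use, `B` is the larger of two nested shelters and `K` is what the searchers common to both
  -- words leave free. Inside `B` one vertex `c` of the old shelter reaches all of the new one, and
  -- walks of `H′` lead on to the rest of the space.
  place-move : ∀ gv {H C H′ C′ K B} → IsSCC G H C → H′ ⊆ K →
               StronglyConnected G B → B ⊆ K → C ⊆ B → C′ ⊆ B →
               ∀ {w} → w ∈ place gv H′ C′ → ∃ λ u → u ∈ place gv H C × RobberMove G gv K u w
  place-move gv {H} {C} {H′} {C′} {K} (C⊆H , ((c , c∈C) , _) , _) H′⊆K (_ , sc) B⊆K C⊆B C′⊆B
    w∈ = c , ⊆place gv C⊆H c∈C , moves gv w∈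
    where
    within : ∀ {w} → w ∈ C′ → Mutual K c w
    within w∈ = reachable-mono B⊆K (sc (C⊆B c∈C) (C′⊆B w∈)) ,
                reachable-mono B⊆K (sc (C′⊆B w∈) (C⊆B c∈C))

    outside′ : ∀ {w} → w ∈ outset H′ C′ → Reachable G K c w
    outside′ w∈ with ∈-comprehension⁻ (out? H′ C′) w∈
    ... | a , a∈ , r = reachable-trans (proj₁ (within a∈)) (reachable-mono H′⊆K r)

    moves : ∀ gv {w} → w ∈ place gv H′ C′ → RobberMove G gv K c w
    moves i   = outside′
    moves isc = mutual⇒sameSCC ∘ within
    moves v   = outside′
    moves vsc = mutual⇒sameSCC ∘ within

  module _ {gv : Variant G} where

    evade : Word G → Subgraph G
    evade X = place gv (∁ (letters G X)) (shelter X)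

    evade-isPosition : ∀ {X} → length X ≤ cr G → IsPosition G gv (X , evade X)
    evade-isPosition {X} len = place⊆ gv (proj₁ (shelter-isSCC X len)) ,
      place-admissible gv (shelter-isSCC X len)

    evade-nonempty : ∀ {X} → length X ≤ cr G → Nonempty (evade X)
    evade-nonempty {X} len with shelter-isSCC X len
    ... | C⊆ , ((c , c∈) , _) , _ = c , ⊆place gv C⊆ c∈

    -- Giving up is always a legal answer, so the reply is defined against every strategy, even one
    -- that places too many searchers.
    reply : Position G → Word G → Subgraph G
    reply p X with nonempty? (robber G p) ×-dec length X ℕ.≤? cr G
    ... | yes _ = evade X
    ... | no  _ = ⊥

    -- `initial` is separate: a play starts from the whole vertex set, which may differ from
    -- `evade []` and, for `v` and `vsc`, may fail to be a position.
    data Evading : Position G → Set where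
      initial : Evading (start G)
      hidden  : ∀ {X} → length X ≤ cr G → Evading (X , evade X)
      caught  : ∀ {X} → Evading (X , ⊥)

    evading-isPosition⁺ : ∀ {p} → Evading p → IsPosition⁺ G gv p
    evading-isPosition⁺ initial          = inj₂ refl
    evading-isPosition⁺ (hidden {X} len) = inj₁ (evade-isPosition {X} len)
    evading-isPosition⁺ (caught {X})     = inj₁ (⊥-isPosition gv {X})

    reply-evading : ∀ p X → Evading (X , reply p X)
    reply-evading p X with nonempty? (robber G p) ×-dec length X ℕ.≤? cr G
    ... | yes (_ , len) = hidden len
    ... | no  _         = caught

    reply-nonempty : ∀ {p X} → Nonempty (robber G p) → length X ≤ cr G → Nonempty (reply p X)
    reply-nonempty {p} {X} ne len with nonempty? (robber G p) ×-dec length X ℕ.≤? cr G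
    ... | yes _ = evade-nonempty {X} len
    ... | no ¬q = contradiction (ne , len) ¬q

    evading-moves : ∀ {X R X′} → Evading (X , R) → Nonempty R → length X′ ≤ cr G →
                    _≼_ G X X′ ⊎ _≼_ G X′ X →
                    ∀ {w} → w ∈ evade X′ →
                    ∃ λ u → u ∈ R × RobberMove G gv (∁ (letters G X ∩ letters G X′)) u w
    evading-moves {X′ = X′} initial ne len′ _ {w} w∈ =
      w , ∈⊤ , mutual⇒move gv ((w∈K , ε) , (w∈K , ε))
      where
      w∈K = p⊆q⇒∁p⊇∁q (p∩q⊆q (letters G []) (letters G X′)) (proj₁ (evade-isPosition {X′} len′) w∈)
    evading-moves {X} {X′ = X′} (hidden len) ne len′ pre with shelter-isSCC X len | shelter-isSCC X′ len′
    ... | C-scc@(C⊆ , sc , _) | (C′⊆ , sc′ , _) = λ w∈ → [ down , up ]′ pre w∈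
      where
      Y = letters G X
      Y′ = letters G X′
      ∁⊆ : ∁ Y ⊆ ∁ (Y ∩ Y′)
      ∁⊆ = p⊆q⇒∁p⊇∁q (p∩q⊆p Y Y′)
      ∁⊆′ : ∁ Y′ ⊆ ∁ (Y ∩ Y′)
      ∁⊆′ = p⊆q⇒∁p⊇∁q (p∩q⊆q Y Y′)
      Moves = ∀ {w} → w ∈ evade X′ → ∃ λ u → u ∈ evade X × RobberMove G gv (∁ (Y ∩ Y′)) u w

      down : _≼_ G X X′ → Moves
      down pre = place-move gv C-scc ∁⊆′ sc (∁⊆ ∘ C⊆) id (shelter-anti pre)

      up : _≼_ G X′ X → Moves
      up pre = place-move gv C-scc ∁⊆′ sc′ (∁⊆′ ∘ C′⊆) (shelter-anti pre) id
    evading-moves caught (_ , x∈) = contradiction x∈ ∉⊥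

    -- `legal` promises some successor with the prescribed word and says nothing of its robber
    -- space. The conditions on the words survive when that space is replaced by the reply.
    reply-successor : ∀ {p q} → Evading p → Successor G gv p q →
                      Successor G gv p (searchers G q , reply p (searchers G q))
    reply-successor {p} {X′ , _} ev (move pos _ pre one _)
      with nonempty? (robber G p) ×-dec length X′ ℕ.≤? cr G
    ... | yes (ne , len) = move pos (evade-isPosition {X′} len) pre one (evading-moves ev ne len pre)
    ... | no  _ = move pos (⊥-isPosition gv {X′}) pre one λ w∈ → contradiction w∈ ∉⊥
    reply-successor ev (enter ¬pos _)
      with nonempty? (⊤ {order}) ×-dec 0 ℕ.≤? cr G
    ... | yes (_ , len) = enter ¬pos (evade-isPosition {[]} len)
    ... | no  _ = enter ¬pos (⊥-isPosition gv {[]})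

    module _ (S : Strategy G gv) where
      open Strategy S

      play : ℕ → Position G
      play zero    = start G
      play (suc n) = σ (play n) , reply (play n) (σ (play n))

      play-evading : ∀ n → Evading (play n)
      play-evading zero    = initial
      play-evading (suc n) = reply-evading (play n) (σ (play n))

      play-step : ∀ n → Successor G gv (play n) (play (suc n))
      play-step n with legal (evading-isPosition⁺ (play-evading n))
      ... | q , succ , X≡ = subst (λ X → Successor G gv (play n) (X , reply (play n) X)) X≡
        (reply-successor (play-evading n) succ)

      -- With `k ≤ cr G` the replies would stay nonempty forever. The resulting search is infinite,
      -- hence complete, and consistent by construction, so winning contradicts this.
      lower-bound : Winning G S → ∀ {k} → UsesAtMostSearchers G S k → suc (cr G) ≤ k
      lower-bound win {k} bound = ℕ.≰⇒> λ k≤cr → escapes k≤cr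
        where
        s : Sequence G
        s = infinite play

        search : IsSearchFrom G gv (start G) s
        search = refl , (λ n → evading-isPosition⁺ (play-evading n)) , play-step

        survives : k ≤ cr G → ∀ n → Nonempty (robber G (play n))
        survives k≤cr zero    = someVertex , ∈⊤
        survives k≤cr (suc n) = reply-nonempty {play n} (survives k≤cr n)
          (ℕ.≤-trans (bound s search (inj₁ tt) (λ _ → refl) (suc n)) k≤cr)

        escapes : ¬ (k ≤ cr G)
        escapes k≤cr with win s search (inj₁ tt) (λ _ → refl)
        ... | n , R≡⊥ with subst Nonempty R≡⊥ (survives k≤cr n)
        ... | _ , x∈ = ∉⊥ x∈

-- Words of searchers, zones, and the choice of the next vertex.

module Words (G : Digraph) where
  open Digraph G using (order)
  open Components G

  letters-++ : ∀ X Y → letters G (X ++ Y) ≡ letters G X ∪ letters G Y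
  letters-++ []      Y = sym (∪-identityˡ (letters G Y))
  letters-++ (a ∷ X) Y = trans (cong (⁅ a ⁆ ∪_) (letters-++ X Y))
    (sym (∪-assoc ⁅ a ⁆ (letters G X) (letters G Y)))

  letters-∷ʳ : ∀ X a → letters G (X ∷ʳ a) ≡ letters G X ∪ ⁅ a ⁆
  letters-∷ʳ X a = trans (letters-++ X (a ∷ [])) (cong (letters G X ∪_) (∪-identityʳ ⁅ a ⁆))

  free : Word G → Subgraph G
  free X = ∁ (letters G X)

  free-∷ʳ : ∀ X a → free (X ∷ʳ a) ≡ free X - a
  free-∷ʳ X a = trans (cong ∁ (letters-∷ʳ X a))
    (trans (sym (⊤─≡∁ (letters G X ∪ ⁅ a ⁆)))
    (trans (sym (p─q─r≡p─q∪r ⊤ (letters G X) ⁅ a ⁆)) (cong (_- a) (⊤─≡∁ (letters G X)))))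

  fresh-△ : ∀ X {a} → a ∉ letters G X → ∣ letters G X △ letters G (X ∷ʳ a) ∣ ≡ 1
  fresh-△ X {a} a∉ rewrite letters-∷ʳ X a | △-insert a∉ = ∣⁅x⁆∣≡1 a

  ∩-absorb : ∀ X a → letters G X ∩ letters G (X ∷ʳ a) ≡ letters G X
  ∩-absorb X a rewrite letters-∷ʳ X a = ∩-abs-∪ (letters G X) ⁅ a ⁆

  ≼-refl : ∀ X → _≼_ G X X
  ≼-refl []      = []
  ≼-refl (a ∷ X) = refl ∷ ≼-refl X

  ≼-∷ʳ : ∀ X {a} → _≼_ G X (X ∷ʳ a)
  ≼-∷ʳ X = ≼-refl X ++ᵖ _

  length-∷ʳ : ∀ (X : Word G) {a} → length (X ∷ʳ a) ≡ suc (length X)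
  length-∷ʳ X = trans (length-++ X) (ℕ.+-comm (length X) 1)

  retreatʳ : ∀ {X : Word G} → Reverse X → Word G
  -- With no searcher to lift, a move has to place one; this default is why the bound in
  -- `retreat-length` has the form `suc c`.
  retreatʳ [] = someVertex ∷ []
  retreatʳ (X ∶ rs ∶ʳ a) with a ∈? letters G X
  ... | yes _ = retreatʳ rs
  ... | no  _ = X

  -- Words may repeat letters, so dropping the last one need not be a legal move.
  retreat : Word G → Word G
  retreat X = retreatʳ (reverseView X)

  reverseView-∷ʳ : ∀ (X : Word G) a → reverseView (X ∷ʳ a) ≡ X ∶ reverseView X ∶ʳ a
  reverseView-∷ʳ X a = reverse-unique (reverseView (X ∷ʳ a)) (X ∶ reverseView X ∶ʳ a) refl

  retreat-∷ʳ : ∀ X {a} → a ∉ letters G X → retreat (X ∷ʳ a) ≡ X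
  retreat-∷ʳ X {a} a∉ = trans (cong retreatʳ (reverseView-∷ʳ X a)) (fresh (reverseView X))
    where
    fresh : ∀ rs → retreatʳ (X ∶ rs ∶ʳ a) ≡ X
    fresh rs with a ∈? letters G X
    ... | yes a∈ = contradiction a∈ a∉
    ... | no  _  = refl

  Adjacent : Word G → Word G → Set
  Adjacent X Y = (_≼_ G X Y ⊎ _≼_ G Y X) × ∣ letters G X △ letters G Y ∣ ≡ 1

  extension-adjacent : ∀ X {a} → a ∈ free X → Adjacent X (X ∷ʳ a)
  extension-adjacent X a∈ = inj₁ (≼-∷ʳ X) , fresh-△ X (x∈∁p⇒x∉p a∈)

  ≼-trans : ∀ {X Y Z} → _≼_ G X Y → _≼_ G Y Z → _≼_ G X Z
  ≼-trans [] _ = []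
  ≼-trans (refl ∷ p) (refl ∷ q) = refl ∷ ≼-trans p q

  retreat-adjacent : ∀ X → Adjacent X (retreat X)
  retreat-adjacent X = go (reverseView X)
    where
    shorter : ∀ {X : Word G} (rs : Reverse X) {b} → b ∈ letters G X →
              _≼_ G (retreatʳ rs) X × ∣ letters G X △ letters G (retreatʳ rs) ∣ ≡ 1
    shorter [] b∈ = contradiction b∈ ∉⊥
    shorter (X ∶ rs ∶ʳ a) _ with a ∈? letters G X
    ... | no a∉ = ≼-∷ʳ X ,
      trans (cong ∣_∣ (△-comm (letters G (X ∷ʳ a)) (letters G X))) (fresh-△ X a∉)
    ... | yes a∈ with shorter rs a∈
    ... | pre , one = ≼-trans pre (≼-∷ʳ X) , trans (cong (λ p → ∣ p △ letters G (retreatʳ rs) ∣) same) one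
      where
      same : letters G (X ∷ʳ a) ≡ letters G X
      same = trans (letters-∷ʳ X a) (⊆-antisym
        (λ x∈ → [ id , (λ x∈a → subst (_∈ letters G X) (sym (x∈⁅y⁆⇒x≡y a x∈a)) a∈) ]′
          (x∈p∪q⁻ (letters G X) ⁅ a ⁆ x∈))
        (p⊆p∪q ⁅ a ⁆))

    go : ∀ {X : Word G} (rs : Reverse X) → Adjacent X (retreatʳ rs)
    go [] = extension-adjacent [] (x∉p⇒x∈∁p ∉⊥)
    go rs@(X ∶ _ ∶ʳ a) with shorter rs {a}
      (subst (a ∈_) (sym (letters-∷ʳ X a)) (q⊆p∪q (letters G X) ⁅ a ⁆ (x∈⁅x⁆ a)))
    ... | pre , one = inj₂ pre , one

  retreat-length : ∀ X {c} → length X ≤ suc c → length (retreat X) ≤ suc c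
  retreat-length X = go (reverseView X)
    where
    go : ∀ {X : Word G} (rs : Reverse X) {c} → length X ≤ suc c → length (retreatʳ rs) ≤ suc c
    go [] len = s≤s z≤n
    go (X ∶ rs ∶ʳ a) {c} len with a ∈? letters G X | ℕ.<⇒≤ (subst (_≤ suc c) (length-∷ʳ X) len)
    ... | yes _ | len′ = go rs len′
    ... | no  _ | len′ = len′

  -- A strategy sees only the current position, so the component in which the last searcher was
  -- placed is recomputed from the word: it is taken in what the earlier letters leave free.
  zoneʳ : ∀ {X : Word G} → Reverse X → Subgraph G
  zoneʳ [] = ⊤
  zoneʳ (X ∶ _ ∶ʳ a) = comp (free X) a - a

  zone : Word G → Subgraph G
  zone X = zoneʳ (reverseView X)

  zone-∷ʳ : ∀ X a → zone (X ∷ʳ a) ≡ comp (free X) a - a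
  zone-∷ʳ X a = cong zoneʳ (reverseView-∷ʳ X a)

  -- A minimal element of `S` for the reachability preorder of `H`; the walks are those of `H` and
  -- may leave `S`.
  Source : Subgraph G → Subgraph G → Fin order → Set
  Source H S w = w ∈ S × (∀ {u} → u ∈ S → Reachable G H u w → Reachable G H w u)

  -- If some `u` in `S` reaches `w` and is not reached back, pass to `u`: the set of vertices of `S`
  -- reaching the current one shrinks, since `w` drops out.
  source : ∀ H {S} → Nonempty S → ∃ (Source H S)
  source H {S} (w , w∈S) = go w w∈S (⊂-wellFounded (above w))
    where
    above? : ∀ w u → Dec (u ∈ S × Reachable G H u w)
    above? w u = u ∈? S ×-dec Reachable? H u w

    above : Fin order → Subgraph G
    above w = comprehension (above? w)

    go : ∀ w → w ∈ S → Acc _⊂_ (above w) → ∃ (Source H S)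
    go w w∈S (acc rec) with any? (λ u → above? w u ×-dec ¬? (Reachable? H w u))
    ... | no none = w , w∈S , λ {u} u∈S r → decidable-stable (Reachable? H w u)
      λ ¬r → none (u , (u∈S , r) , ¬r)
    ... | yes (u , (u∈S , r) , ¬r) = go u u∈S (rec (⊆′ , w , w∈ , w∉))
      where
      ⊆′ : above u ⊆ above w
      ⊆′ x∈ with ∈-comprehension⁻ (above? u) x∈
      ... | x∈S , s = ∈-comprehension⁺ (above? w) (x∈S , reachable-trans s r)
      w∈ : w ∈ above w
      w∈ = ∈-comprehension⁺ (above? w) (w∈S , reachable-target r , ε)
      w∉ : w ∉ above u
      w∉ w∈ = ¬r (proj₂ (∈-comprehension⁻ (above? u) w∈))

  abstract
    hub : Subgraph G → Fin order
    hub C with stronglyConnected? G C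
    ... | yes sc = proj₁ (hub-exists sc)
    ... | no  _  = someVertex

    hub-correct : ∀ {C} → StronglyConnected G C →
                  hub C ∈ C × (∀ {E} → IsSCC G (C - hub C) E → rank E < rank C)
    hub-correct {C} sc with stronglyConnected? G C
    ... | yes sc′ = proj₂ (hub-exists sc′)
    ... | no  ¬sc = contradiction sc ¬sc

-- Upper bounds: one pursuit strategy for all four games.

module Pursuit (G : Digraph) where
  open Digraph G using (order; _⟶_; _⟶?_)
  open Components G
  open Words G

  Stable : Variant G → Subgraph G → Subgraph G → Set
  Stable gv H R = ∀ {u w} → u ∈ R → RobberMove G gv H u w → w ∈ R

  closed-stable : ∀ {H R u w} → SuccessorClosed G H R → u ∈ R → Reachable G H u w → w ∈ R
  closed-stable closed u∈ (_ , p) = walk-target u∈ (closed-reachable closed u∈ p)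

  sameSCC-absorbed : ∀ {H C u w} → IsSCC G H C → u ∈ C → SameSCC G H u w → w ∈ C
  sameSCC-absorbed C-scc u∈ m = mutual-absorbed C-scc u∈ (sameSCC⇒mutual m)

  -- Successor-closed sets are closed under walks, unions of components under `SameSCC`. This common
  -- form of admissibility yields monotonicity in all four games at once.
  position-stable : ∀ gv {X R} → IsPosition G gv (X , R) → Stable gv (free X) R
  position-stable i   (_ , closed) = closed-stable closed
  position-stable isc (_ , _ , Cs-scc , refl) u∈ m =
    ⋃-closed Cs-scc (λ C-scc u∈C → sameSCC-absorbed C-scc u∈C m) u∈
  position-stable v   (_ , inj₁ refl) u∈ _   = contradiction u∈ ∉⊥
  position-stable v   (_ , inj₂ (closed , _)) = closed-stable closed
  position-stable vsc (_ , inj₁ refl) u∈ _   = contradiction u∈ ∉⊥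
  position-stable vsc (_ , inj₂ C-scc)       = sameSCC-absorbed C-scc

  walk-avoiding : ∀ {H} a {u w} → u ∈ H → Star (Edge G H) u w →
                  Reachable G H u a ⊎ Reachable G (H - a) u w
  walk-avoiding a {u} u∈ p with u ≟ᶠ a
  ... | yes refl = inj₁ (u∈ , ε)
  walk-avoiding a u∈ ε | no u≢a = inj₂ (x∈p∧x≢y⇒x∈p-y u∈ u≢a , ε)
  walk-avoiding a u∈ (e@(_ , b∈ , u⟶b) ◅ p) | no u≢a with walk-avoiding a b∈ p
  ... | inj₁ (_ , q)   = inj₁ (u∈ , e ◅ q)
  ... | inj₂ (b∈′ , q) = inj₂ (u∈′ , (u∈′ , b∈′ , u⟶b) ◅ q)
    where u∈′ = x∈p∧x≢y⇒x∈p-y u∈ u≢a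

  sameSCC-avoiding : ∀ {H} a {u w} → SameSCC G H u w → Reachable G H u a ⊎ SameSCC G (H - a) u w
  sameSCC-avoiding {H} a (C , C-scc@(C⊆H , (_ , sc) , _) , u∈ , w∈) with a ∈? C
  ... | yes a∈ = inj₁ (reachable-mono C⊆H (sc u∈ a∈))
  ... | no  a∉ = inj₂ (C , isSCC-restrict C-scc (∈-remove G) C⊆H-a , u∈ , w∈)
    where
    C⊆H-a : C ⊆ H - a
    C⊆H-a x∈ = x∈p∧x≢y⇒x∈p-y (C⊆H x∈) λ { refl → a∉ x∈ }

  -- A move that becomes possible only when the searcher leaves `a` involves `a`: the walk meets it,
  -- or the component contains it.
  move-avoiding : ∀ gv {H} a {u w} → RobberMove G gv H u w →
                  Reachable G H u a ⊎ RobberMove G gv (H - a) u w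
  move-avoiding i   a (u∈ , p) = walk-avoiding a u∈ p
  move-avoiding isc a m        = sameSCC-avoiding a m
  move-avoiding v   a (u∈ , p) = walk-avoiding a u∈ p
  move-avoiding vsc a m        = sameSCC-avoiding a m

  isInitialComponent? : ∀ H C → Dec (IsInitialComponent G H C)
  isInitialComponent? H C = isSCC? G H C ×-dec
    map′ (λ f {u} {w} → f u w) (λ f u w → f)
      (all? λ u → all? λ w → u ∈? (H ─ C) →-dec (w ∈? C →-dec ¬? (u ⟶? w)))

  uniqueInitialComponent? : ∀ H → Dec (∃! _≡_ (IsInitialComponent G H))
  uniqueInitialComponent? H = anySubset? λ C → isInitialComponent? H C ×-dec
    map′ (λ none {D} I → decidable-stable (≡-dec _≟ᵇ_ C D) λ C≢D → none (D , I , C≢D))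
         (λ unique (D , I , C≢D) → C≢D (unique I))
         (¬? (anySubset? λ D → isInitialComponent? H D ×-dec ¬? (≡-dec _≟ᵇ_ C D)))

  ⊤⊆free : ⊤ ⊆ free []
  ⊤⊆free _ = x∉p⇒x∈∁p ∉⊥

  ⊤-closed : SuccessorClosed G (free []) ⊤
  ⊤-closed _ w∈ = contradiction ∈⊤ (x∈p─q⇒x∉q w∈)

  start? : ∀ gv → Dec (IsPosition G gv (start G))
  start? i   = yes (⊤⊆free , ⊤-closed)
  start? isc = yes (⊤⊆free , map (comp (free [])) (allFin order) ,
    map⁺ (universal (λ a → comp-isSCC (⊤⊆free ∈⊤)) (allFin order)) ,
    ⊆-antisym (λ {x} _ → ∈-⋃⁺ (self∈comp (⊤⊆free ∈⊤)) (∈-map⁺ (comp (free [])) (∈-allFin x))) ⊆⊤)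
  start? v with uniqueInitialComponent? ⊤
  ... | yes u = yes (⊤⊆free , inj₂ (⊤-closed , u))
  ... | no ¬u = no λ { (_ , inj₁ ⊤≡⊥) → nonempty≢⊥ (someVertex , ∈⊤) ⊤≡⊥ ; (_ , inj₂ (_ , u)) → ¬u u }
  start? vsc with isSCC? G (free []) ⊤
  ... | yes scc = yes (⊤⊆free , inj₂ scc)
  ... | no ¬scc = no λ { (_ , inj₁ ⊤≡⊥) → nonempty≢⊥ (someVertex , ∈⊤) ⊤≡⊥ ; (_ , inj₂ scc) → ¬scc scc }

  Guarded : Subgraph G → Subgraph G → Subgraph G → Set
  Guarded H R Z = ∀ {u w} → u ∈ R → w ∈ Z → Reachable G H u w → u ∈ Z

  Bounded : Subgraph G → ℕ → Set
  Bounded Z r = ∀ {E} → IsSCC G Z E → rank E < r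

  -- The invariant behind a word: every letter was placed in a component that the rest of the robber
  -- space cannot enter. The index is the number of searchers left and exceeds the rank of every
  -- component of the zone.
  data Tower (R : Subgraph G) : Word G → ℕ → Set where
    root   : Tower R [] (suc (cr G))
    storey : ∀ {X r C a} → Tower R X (suc r) → IsSCC G (free X) C → a ∈ C →
             Guarded (free X) R C → Bounded (C - a) r → Tower R (X ∷ʳ a) r

  tower-anti : ∀ {R R′ X r} → R′ ⊆ R → Tower R X r → Tower R′ X r
  tower-anti R′⊆R root = root
  tower-anti R′⊆R (storey t C-scc a∈C guarded bounded) =
    storey (tower-anti R′⊆R t) C-scc a∈C (λ u∈ → guarded (R′⊆R u∈)) bounded

  -- What a tower says about its top zone. By `whole`, the component in `H` of a vertex of `Z` is
  -- also a component of `Z`, so `bounded` applies to it.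
  record Zoned (H R Z : Subgraph G) (r : ℕ) : Set where
    field
      ⊆free   : Z ⊆ H
      whole   : ∀ {w} → w ∈ Z → comp H w ⊆ Z
      guarded : Guarded H R Z
      bounded : Bounded Z r

    comp-isSCC-zone : ∀ {w} → w ∈ Z → IsSCC G Z (comp H w)
    comp-isSCC-zone w∈ = isSCC-restrict (comp-isSCC (⊆free w∈)) ⊆free (whole w∈)

  tower-zoned : ∀ {R X r} → R ⊆ free X → Tower R X r → Zoned (free X) R (zone X) r
  tower-zoned _ root = record
    { ⊆free   = ⊤⊆free
    ; whole   = λ _ → ⊆⊤
    ; guarded = λ _ _ _ → ∈⊤
    ; bounded = λ {E} E-scc → s≤s (subst (rank E ≤_) rank-⊤ (rank-scc-≤ E-scc))
    }
  tower-zoned {R} {r = r} R⊆ (storey {X} {_} {C} {a} t C-scc@(C⊆ , _) a∈C guarded bounded)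
    = subst (λ H → Zoned H R (zone (X ∷ʳ a)) r) (sym (free-∷ʳ X a))
      (subst (λ Z → Zoned (free X - a) R Z r)
        (sym (trans (zone-∷ʳ X a) (cong (_- a) (sym (isSCC⇒≡comp C-scc a∈C)))))
        record
          { ⊆free   = remove-mono a C⊆
          ; whole   = λ w∈ x∈ → x∈p∧x∉q⇒x∈p─q (mutual-absorbed C-scc (∈-remove G w∈)
              (mutual-mono (∈-comp⁻ x∈))) (x∈p─q⇒x∉q (comp⊆ x∈))
          ; guarded = λ u∈ w∈ p → x∈p∧x∉q⇒x∈p─q
              (guarded u∈ (∈-remove G w∈) (reachable-mono (∈-remove G) p))
              (x∈p─q⇒x∉q (subst (_ ∈_) (free-∷ʳ X a) (R⊆ u∈)))
          ; bounded = bounded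
          })
    where
    mutual-mono : ∀ {x y} → Mutual (free X - a) x y → Mutual (free X) x y
    mutual-mono (p , q) = reachable-mono (∈-remove G) p , reachable-mono (∈-remove G) q

  module _ (gv : Variant G) where

    target : Word G → Fin order → Fin order
    target X w = hub (comp (free X) w)

    -- The strategy as a relation, so that proofs can split on the order given. The function from
    -- `IsPosition⁺` to `IsPosition` records that the order is not issued at a special start,
    -- without deciding whether the pair is a position.
    data Order : Position G → Word G → Set where
      idle   : ∀ {X} → Order (X , ⊥) (retreat X)
      await  : ¬ IsPosition G gv (start G) → Order (start G) []
      attack : ∀ {X R w} → (IsPosition⁺ G gv (X , R) → IsPosition G gv (X , R)) →
               Source (free X) (R ∩ zone X) w → Order (X , R) (X ∷ʳ target X w)
      recede : ∀ {X R} → (IsPosition⁺ G gv (X , R) → IsPosition G gv (X , R)) →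
               Nonempty R → Empty (R ∩ zone X) → Order (X , R) (retreat X)

    command : ∀ p → ∃ (Order p)
    command (X , R) with nonempty? R
    ... | no empty with Empty-unique empty
    ... | refl = _ , idle
    command (X , R) | yes ne = go (start? gv) (≡-dec _≟ᵇ_ R ⊤) X
      where
      engage : ∀ X → (IsPosition⁺ G gv (X , R) → IsPosition G gv (X , R)) → ∃ (Order (X , R))
      engage X pos with nonempty? (R ∩ zone X)
      ... | yes ne′   = _ , attack pos (proj₂ (source (free X) ne′))
      ... | no empty = _ , recede pos ne empty

      go : Dec (IsPosition G gv (start G)) → Dec (R ≡ ⊤) → ∀ X → ∃ (Order (X , R))
      go (no ¬pos) (yes refl) []       = _ , await ¬pos
      go (yes pos) (yes refl) []       = engage [] λ _ → pos
      go _         (no R≢⊤)   []       = engage []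
        λ { (inj₁ pos) → pos ; (inj₂ refl) → contradiction refl R≢⊤ }
      go _         _          X@(_ ∷ _) = engage X λ { (inj₁ pos) → pos ; (inj₂ ()) }

    component : ∀ {X R w} → IsPosition G gv (X , R) → Source (free X) (R ∩ zone X) w →
                IsSCC G (free X) (comp (free X) w) × w ∈ R × w ∈ zone X
    component {X} {R} (R⊆ , _) (w∈ , _) with x∈p∩q⁻ R (zone X) w∈
    ... | w∈R , w∈Z = comp-isSCC (R⊆ w∈R) , w∈R , w∈Z

    target∈ : ∀ {X R w} → IsPosition G gv (X , R) → Source (free X) (R ∩ zone X) w →
              target X w ∈ comp (free X) w
    target∈ {X} {R} pos s = proj₁ (hub-correct (proj₁ (proj₂ (proj₁ (component {X} {R} pos s)))))

    -- The empty robber space is a legal answer in every game, so an order is legal once the words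
    -- are adjacent.
    word-move : ∀ {X R X′} → IsPosition G gv (X , R) → Adjacent X X′ →
                Successor G gv (X , R) (X′ , ⊥)
    word-move {X′ = X′} pos (pre , one) =
      move pos (⊥-isPosition gv {X′}) pre one λ w∈ → contradiction w∈ ∉⊥

    strategy : Strategy G gv
    strategy = record
      { σ     = λ p → proj₁ (command p)
      ; legal = λ {p} pos → obey pos (proj₂ (command p))
      }
      where
      obey : ∀ {p X} → IsPosition⁺ G gv p → Order p X →
             ∃ λ q → Successor G gv p q × searchers G q ≡ X
      obey _ (idle {X}) = _ , word-move (⊥-isPosition gv {X}) (retreat-adjacent X) , refl
      obey _ (await ¬pos) = _ , enter ¬pos (⊥-isPosition gv {[]}) , refl
      obey pos (attack {X} {R} pos! s) =
        _ , word-move (pos! pos) (extension-adjacent X (comp⊆ (target∈ {X} {R} (pos! pos) s))) , refl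
      obey pos (recede {X} pos! _ _) = _ , word-move (pos! pos) (retreat-adjacent X) , refl

    -- A search may continue after the capture; for that phase `caught` keeps just the bound on the
    -- word. In `chasing`, letters and remaining budget have the constant sum `suc (cr G)`.
    data Sound : Position G → Set where
      caught  : ∀ {X} → length X ≤ suc (cr G) → Sound (X , ⊥)
      chasing : ∀ {X R r} → IsPosition G gv (X , R) → Tower R X r →
                length X + r ≡ suc (cr G) → Sound (X , R)

    data Reached : Position G → Set where
      waiting : ¬ IsPosition G gv (start G) → Reached (start G)
      sound   : ∀ {p} → Sound p → Reached p

    start-reached : Reached (start G)
    start-reached with start? gv
    ... | yes pos = sound (chasing pos root refl)
    ... | no ¬pos = waiting ¬pos

    sound-position : ∀ {p} → Sound p → IsPosition G gv p
    sound-position (caught {X} _)    = ⊥-isPosition gv {X}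
    sound-position (chasing pos _ _) = pos

    sound-length : ∀ {p} → Sound p → length (searchers G p) ≤ suc (cr G)
    sound-length (caught len)       = len
    sound-length (chasing {r = r} _ _ eq) = ℕ.m+n≤o⇒m≤o _ (ℕ.≤-reflexive eq)

    -- The robber space counts twice, so that losing one vertex outweighs the letter added by an
    -- attack.
    measure : Position G → ℕ
    measure (X , R) = ∣ R ∣ + ∣ R ∣ + length X

    Progress : Position G → Position G → Set
    Progress p q = Sound q × robber G q ⊆ robber G p ×
      (Nonempty (robber G p) → measure q < measure p)

    Spread : Word G → Subgraph G → Word G → Subgraph G → Set
    Spread X R X′ R′ = ∀ {w} → w ∈ R′ → ∃ λ u → u ∈ R ×
      RobberMove G gv (∁ (letters G X ∩ letters G X′)) u w

    -- The new searcher takes the hub of the component of `w`, and what is left of this component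
    -- has smaller rank. The old searchers stay during the move, so the robber gains nothing and
    -- loses the hub.
    attack-progress : ∀ {X R w R′} → let a = target X w in
      Sound (X , R) → Source (free X) (R ∩ zone X) w →
      IsPosition G gv (X ∷ʳ a , R′) → Spread X R (X ∷ʳ a) R′ →
      Progress (X , R) (X ∷ʳ a , R′)
    attack-progress {X} (caught _) (w∈ , _) _ _ =
      contradiction (proj₁ (x∈p∩q⁻ ⊥ (zone X) w∈)) ∉⊥
    attack-progress {X} {R} {w} {R′} (chasing pos t len) s pos′ spread
      with component {X} {R} pos s | target∈ {X} {R} pos s
    ... | D-scc@(_ , sc , _) , w∈R , w∈Z | a∈D
      with tower-zoned (proj₁ pos) t
    ... | z with Zoned.bounded z (Zoned.comp-isSCC-zone z w∈Z)
    -- The rank of `D` is below the budget, so the budget is a successor and pays for this searcher.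
    ... | s≤s {n = r} D≤r = chasing pos′ tower len′ , R′⊆R , λ _ → shrinks
      where
      a = target X w
      D = comp (free X) w

      stable : Stable gv (free X) R
      stable = position-stable gv {X} pos

      R′⊆R : R′ ⊆ R
      R′⊆R {x} x∈ with spread x∈
      ... | u , u∈ , m = stable u∈ (subst (λ K → RobberMove G gv K u x) (cong ∁ (∩-absorb X a)) m)

      tower : Tower R′ (X ∷ʳ a) r
      tower = tower-anti R′⊆R (storey t D-scc a∈D guarded
        λ E-scc → ℕ.≤-trans (proj₂ (hub-correct sc) E-scc) D≤r)
        where
        guarded : Guarded (free X) R D
        guarded u∈ b∈ u→b with reachable-trans u→b (proj₂ (∈-comp⁻ b∈))
        -- The guard of the old zone puts `u` into it; the source property of `w` then provides a
        -- walk back from `w` to `u`.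
        ... | u→w = ∈-comp⁺ (proj₂ s (x∈p∩q⁺ (u∈ , Zoned.guarded z u∈ w∈Z u→w)) u→w , u→w)

      len′ : length (X ∷ʳ a) + r ≡ suc (cr G)
      len′ = trans (cong (_+ r) (length-∷ʳ X)) (trans (sym (ℕ.+-suc (length X) r)) len)

      a∉R′ : a ∉ R′
      a∉R′ a∈ = ∉-remove (subst (a ∈_) (free-∷ʳ X a) (proj₁ pos′ a∈))

      fewer : ∣ R′ ∣ < ∣ R ∣
      fewer = p⊂q⇒∣p∣<∣q∣ (R′⊆R , a , stable w∈R (mutual⇒move gv (∈-comp⁻ a∈D)) , a∉R′)

      shrinks : measure (X ∷ʳ a , R′) < measure (X , R)
      shrinks = ℕ.≤-trans (ℕ.≤-reflexive eq) (ℕ.+-monoˡ-≤ (length X) (ℕ.+-mono-≤ fewer fewer))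
        where
        m = ∣ R′ ∣
        eq : suc (m + m + length (X ∷ʳ a)) ≡ suc m + suc m + length X
        eq = cong suc (trans (cong (m + m +_) (length-∷ʳ X)) (trans (ℕ.+-suc (m + m) (length X))
          (cong (_+ length X) (sym (ℕ.+-suc m m)))))

    -- The robber space misses all of `C`: the zone by assumption, and `a` because it is occupied.
    -- By the guard none of its vertices reaches `a`, so lifting the searcher opens no new move.
    recede-progress : ∀ {X R X′ R′} → X′ ≡ retreat X → Sound (X , R) →
      Nonempty R → Empty (R ∩ zone X) →
      IsPosition G gv (X′ , R′) → Spread X R X′ R′ → Progress (X , R) (X′ , R′)
    recede-progress _ (caught _) (_ , x∈) _ _ _ = contradiction x∈ ∉⊥
    recede-progress _ (chasing _ root _) (x , x∈) empty _ _ =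
      contradiction (x , x∈p∩q⁺ (x∈ , ∈⊤)) empty
    recede-progress {_} {R} {X′} {R′} back
      (chasing {r = r} pos (storey {X} {C = C} {a} t C-scc@(C⊆ , _) a∈C guarded _) len)
      _ empty pos′ spread with trans back (retreat-∷ʳ X (x∈∁p⇒x∉p (C⊆ a∈C)))
    ... | refl = chasing pos′ (tower-anti R′⊆R t) len′ , R′⊆R , λ _ → shrinks
      where
      disjoint : ∀ {u} → u ∈ R → u ∉ C
      disjoint {u} u∈R u∈C = empty (u , x∈p∩q⁺ (u∈R , subst (u ∈_)
        (sym (trans (zone-∷ʳ X a) (cong (_- a) (sym (isSCC⇒≡comp C-scc a∈C)))))
        (x∈p∧x∉q⇒x∈p─q u∈C (x∈p─q⇒x∉q (subst (u ∈_) (free-∷ʳ X a) (proj₁ pos u∈R))))))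

      stable : Stable gv (free X - a) R
      stable = subst (λ H → Stable gv H R) (free-∷ʳ X a) (position-stable gv {X ∷ʳ a} pos)

      ∁≡ : ∁ (letters G (X ∷ʳ a) ∩ letters G X) ≡ free X
      ∁≡ = cong ∁ (trans (∩-comm (letters G (X ∷ʳ a)) (letters G X)) (∩-absorb X a))

      R′⊆R : R′ ⊆ R
      R′⊆R {x} x∈ with spread x∈
      ... | u , u∈ , m with move-avoiding gv a (subst (λ K → RobberMove G gv K u x) ∁≡ m)
      ... | inj₁ u→a = contradiction (guarded u∈ a∈C u→a) (disjoint u∈)
      ... | inj₂ m′  = stable u∈ m′

      len′ : length X + suc r ≡ suc (cr G)
      len′ = trans (ℕ.+-suc (length X) r) (trans (cong (_+ r) (sym (length-∷ʳ X))) len)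

      shrinks : measure (X , R′) < measure (X ∷ʳ a , R)
      shrinks = ℕ.+-mono-≤-< (ℕ.+-mono-≤ fewer fewer) (ℕ.≤-reflexive (sym (length-∷ʳ X)))
        where fewer = p⊆q⇒∣p∣≤∣q∣ R′⊆R

    progress : ∀ {p q} → Sound p → Order p (searchers G q) → Successor G gv p q → Progress p q
    progress snd _ (enter ¬pos _) = contradiction (sound-position snd) ¬pos
    progress snd (await ¬pos) (move pos _ _ _ _) = contradiction pos ¬pos
    progress snd (attack _ s) (move _ pos′ _ _ spread) = attack-progress snd s pos′ spread
    progress snd (recede {X} _ ne empty) (move _ pos′ _ _ spread) =
      recede-progress {X} refl snd ne empty pos′ spread
    progress snd (idle {X}) (move {R′ = R′} _ _ _ _ spread)
      with ∄⇒≡⊥ {p = R′} (λ x∈ → ∉⊥ (proj₁ (proj₂ (spread x∈))))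
    ... | refl = caught (retreat-length X (sound-length snd)) , id ,
      λ (_ , x∈) → contradiction x∈ ∉⊥

    enter-progress : ∀ {q} → ¬ IsPosition G gv (start G) → Successor G gv (start G) q → Sound q
    enter-progress ¬pos (move pos _ _ _ _) = contradiction pos ¬pos
    enter-progress _    (enter _ pos)      = chasing pos root refl

  Confined : Position G → Set
  Confined (X , R) = R ⊆ zone X

  -- A nonempty robber space of this game is a single component, hence the one containing the
  -- target, and deleting the target leaves the new zone. A nonempty space thus always meets the
  -- zone, so `recede` never arises.
  confined : ∀ {p q} → Sound vsc p → Confined p → Order vsc p (searchers G q) →
             Successor G vsc p q →
             Confined q × (Nonempty (robber G p) → _≼_ G (searchers G p) (searchers G q))
  confined snd con o (enter _ _) = (λ _ → ∈⊤) , λ _ → []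
  confined snd con (await _) (move _ _ _ _ _) = (λ _ → ∈⊤) , λ _ → []
  confined snd con (recede _ (x , x∈) empty) (move _ _ _ _ _) =
    contradiction (x , x∈p∩q⁺ (x∈ , con x∈)) empty
  confined snd con idle (move _ _ _ _ spread) =
    (λ x∈ → contradiction (proj₁ (proj₂ (spread x∈))) ∉⊥) , λ (_ , x∈) → contradiction x∈ ∉⊥
  confined snd con (attack {X} {w = w} _ (w∈ , _)) (move (_ , inj₁ refl) _ _ _ _) =
    contradiction (proj₁ (x∈p∩q⁻ ⊥ (zone X) w∈)) ∉⊥
  confined snd con o@(attack {X} {R} {w} _ s) m@(move pos@(_ , inj₂ R-scc) pos′ _ _ _) =
    (λ x∈ → subst (_ ∈_) (sym (trans (zone-∷ʳ X a) (cong (_- a) (sym (isSCC⇒≡comp R-scc a∈R)))))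
      (x∈p∧x∉q⇒x∈p─q (proj₁ (proj₂ (progress vsc snd o m)) x∈)
        (x∈p─q⇒x∉q (subst (_ ∈_) (free-∷ʳ X a) (proj₁ pos′ x∈)))))
    , λ _ → ≼-∷ʳ X
    where
    a = target vsc X w
    a∈R : a ∈ R
    a∈R = subst (a ∈_) (sym (isSCC⇒≡comp R-scc (proj₁ (proj₂ (component vsc {X} {R} pos s)))))
      (target∈ vsc {X} {R} pos s)

  module _ (gv : Variant G) where
    open Strategy (strategy gv)

    obeyed : ∀ {p X} → X ≡ σ p → Order gv p X
    obeyed {p} eq = subst (Order gv p) (sym eq) (proj₂ (command gv p))

    Preserved : (Position G → Set) → Set
    Preserved P = ∀ {p q} → P p → Order gv p (searchers G q) → Successor G gv p q → P q

    module _ {P : Position G → Set} (base : P (start G)) (next : Preserved P) where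

      throughout : ∀ s → IsSearchFrom G gv (start G) s → IsConsistent G (strategy gv) s →
                   ∀ n → P (at G s n)
      throughout (finite m p) (eq , _ , succ) con =
        <-weakInduction (λ n → P (p n)) (subst P (sym eq) base) λ j pj → next pj (obeyed (con j)) (succ j)
      throughout (infinite p) (eq , _ , succ) con = go
        where
        go : ∀ n → P (p n)
        go zero    = subst P (sym eq) base
        go (suc n) = next (go n) (obeyed (con n)) (succ n)

      steps : ∀ {Q : Position G → Position G → Set} →
              (∀ {p q} → P p → Order gv p (searchers G q) → Successor G gv p q → Q p q) →
              ∀ s → IsSearchFrom G gv (start G) s → IsConsistent G (strategy gv) s →
              ∀ j → Q (before G s j) (after G s j)
      steps f s@(finite m p) search@(_ , _ , succ) con j =
        f (throughout s search con (inject₁ j)) (obeyed (con j)) (succ j)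
      steps f s@(infinite p) search@(_ , _ , succ) con j =
        f (throughout s search con j) (obeyed (con j)) (succ j)

    reached-next : ∀ {p q} → Reached gv p → Order gv p (searchers G q) → Successor G gv p q →
                   Sound gv q × robber G q ⊆ robber G p
    reached-next (waiting ¬pos) _ succ = enter-progress gv ¬pos succ , ⊆⊤
    reached-next (sound snd) o succ with progress gv snd o succ
    ... | snd′ , R′⊆R , _ = snd′ , R′⊆R

    reached-preserved : Preserved (Reached gv)
    reached-preserved r o succ = sound (proj₁ (reached-next r o succ))

    reached-length : ∀ {p} → Reached gv p → length (searchers G p) ≤ suc (cr G)
    reached-length (waiting _) = z≤n
    reached-length (sound snd) = sound-length gv snd

    strategy-bounded : UsesAtMostSearchers G (strategy gv) (1 + cr G)
    strategy-bounded s search _ con n =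
      reached-length (throughout (start-reached gv) reached-preserved s search con n)

    strategy-monotone : Monotone G (strategy gv)
    strategy-monotone s search _ con = steps (start-reached gv) reached-preserved
      {λ p q → robber G q ⊆ robber G p} (λ r o succ → proj₂ (reached-next r o succ)) s search con

    strategy-winning : Winning G (strategy gv)
    strategy-winning s search (inj₂ captures) con = captures
    strategy-winning s@(infinite p) search@(_ , _ , succ) (inj₁ _) con =
      -- The chase starts at index 1, since position 0 may be a special start, which is not sound.
      -- The fuel is one more than the measure at index 1.
      chase _ 1 (proj₁ (reached-next (reached 0) (obeyed (con 0)) (succ 0))) ℕ.≤-refl
      where
      reached : ∀ n → Reached gv (p n)
      reached = throughout (start-reached gv) reached-preserved s search con

      chase : ∀ m n → Sound gv (p n) → measure gv (p n) < m → ∃ λ n → robber G (p n) ≡ ⊥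
      chase (suc m) n snd (s≤s μ≤m) with nonempty? (robber G (p n))
      ... | no empty = n , Empty-unique empty
      ... | yes ne with progress gv snd (obeyed (con n)) (succ n)
      ... | snd′ , _ , shrinks = chase m (suc n) snd′ (ℕ.≤-trans (shrinks ne) μ≤m)

  ReachedConfined : Position G → Set
  ReachedConfined p = Reached vsc p × Confined p

  confined-next : ∀ {p q} → ReachedConfined p → Order vsc p (searchers G q) →
                  Successor G vsc p q →
                  Confined q × (Nonempty (robber G p) → _≼_ G (searchers G p) (searchers G q))
  confined-next (sound snd , con) o succ = confined snd con o succ
  confined-next (waiting ¬pos , _) _ (move pos _ _ _ _) = contradiction pos ¬pos
  confined-next (waiting _ , _) _ (enter _ _) = (λ _ → ∈⊤) , λ _ → []

  strategy-stationary : SearcherStationary G (strategy vsc)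
  strategy-stationary s search _ con = steps vsc
    {ReachedConfined} (start-reached vsc , λ _ → ∈⊤)
    (λ rc o succ → reached-preserved vsc (proj₁ rc) o succ , proj₁ (confined-next rc o succ))
    {λ p q → robber G p ≢ ⊥ → _≼_ G (searchers G p) (searchers G q)}
    (λ {p} rc o succ R≢⊥ → proj₂ (confined-next rc o succ)
      (decidable-stable (nonempty? (robber G p)) (R≢⊥ ∘ Empty-unique)))
    s search con

-- Matching bounds for all the search numbers.

module _ (G : Digraph) where
  open Evasion G using (lower-bound)
  open Pursuit G

  lifo-monotone : ∀ gv → IsLifoᵐ G gv (1 + cr G)
  lifo-monotone gv =
    (strategy gv , strategy-monotone gv , strategy-winning gv , strategy-bounded gv) ,
    λ (S , _ , win , bound) → lower-bound S win bound

  lifo : ∀ gv → IsLifo G gv (1 + cr G)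
  lifo gv = (strategy gv , strategy-winning gv , strategy-bounded gv) ,
    λ (S , win , bound) → lower-bound S win bound

  sstat : IsSstatVsc G (1 + cr G)
  sstat = (strategy vsc , strategy-stationary , strategy-winning vsc , strategy-bounded vsc) ,
    λ (S , _ , win , bound) → lower-bound S win bound

theorem1 : (G : Digraph) →
    let k = 1 + cr G in
    IsLifoᵐ G i k × IsLifo G i k ×
    IsLifoᵐ G isc k × IsLifo G isc k ×
    IsLifoᵐ G v k × IsLifo G v k ×
    IsLifoᵐ G vsc k × IsLifo G vsc k ×
    IsSstatVsc G k
theorem1 G = lifo-monotone G i , lifo G i , lifo-monotone G isc , lifo G isc ,
  lifo-monotone G v , lifo G v , lifo-monotone G vsc , lifo G vsc , sstat G
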